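{- Let $G$ be a connected graph with $m = |V(G)| > 1$ and let $H$ be a connected graph with $n = |V(H)|$. Then $$\mathcal{V}(G\odot H) = \mathcal{V}(G) + \left((1+x)^{mn}-1\right) + m x\left(\mathcal{V}_2(H)-1\right) + \sum_Q p_Q(x),$$ where the sum runs over all non-empty proper subsets $Q \subsetneq V(G)$ that are mutual-visibility sets of $G$, and $$p_Q(x) = \begin{cases} \displaystyle\sum_{\Omega_Q(G)} \left((1+x)^{|\Omega_Q(G)|\,n}-1\right)x^{|Q|} & \text{if } Q \text{ is disjoint-visible},\\[8pt] \displaystyle\sum_{\emptyset\neq \mathcal{J}\subseteq \Gamma_Q(G)} (-1)^{|\mathcal{J}|+1}\left((1+x)^{\left|\bigcap_{W\in\mathcal{J}} W\right|\,n}-1\right)x^{|Q|} & \text{otherwise},\end{cases}$$ with the sum in the first case over all maximal absolute $c_Q$-visible sets $\Omega_Q(G)$ of $G$.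
   Context: All graphs are finite, simple, undirected and connected. For a graph $G$ and $X \subseteq V(G)$, two vertices $u,v$ are $X$-visible if there exists a shortest $(u,v)$-path $P$ in $G$ with $V(P)\cap X \subseteq \{u,v\}$; a set $Y$ is $X$-visible if every two vertices of $Y$ are $X$-visible. A set $X\subseteq V(G)$ is a mutual-visibility set of $G$ if it is $X$-visible (the empty set counts). The visibility polynomial is $\mathcal{V}(G)=\sum_{i\ge0} r_i x^i$, where $r_i$ is the number of mutual-visibility sets of $G$ of cardinality $i$. For $X\subseteq V(G)$, $\operatorname{diam}_G(X)=\max_{u,v\in X}d_G(u,v)$. The diameter-restricted visibility polynomial is $\mathcal{V}_d(G)=\sum_{i\ge 0} r_{i,d}x^i$, where $r_{i,d}$ is the number of mutual-visibility sets of $G$ of cardinality $i$ with $\operatorname{diam}_G$ at most $d$ (so $r_{0,d}=1$). For $Q\subseteq V(G)$, a set $W\subseteq \overline{Q}=V(G)\setminus Q$ is $c_Q$-visible if $W$ is $Q$-visible and $u,w$ are $Q$-visible for all $u\in Q$, $w\in W$; it is an absolute $c_Q$-visible set if moreover $Q$ is a mutual-visibility set of $G$. A maximal absolute $c_Q$-visible set (one not properly contained in another absolute $c_Q$-visible set) is denoted $\Omega_Q(G)$, and $\Gamma_Q(G)$ is the collection of all of them. $Q$ is disjoint-visible if, whenever there is more than one maximal absolute $c_Q$-visible set, these sets are pairwise disjoint. The corona $G\odot H$ is obtained from one copy of $G$ and $|V(G)|$ copies of $H$, the copy associated with $v\in V(G)$ being denoted $H_v$, by joining each $v \in V(G)$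 to every vertex of $H_v$. -}

module Defs where

open import Data.Bool using (Bool; true; false; _∧_; _∨_; not; if_then_else_)
open import Data.Nat using (ℕ; zero; suc; _≤ᵇ_; _<ᵇ_; _≡ᵇ_)
import Data.Nat as ℕ
open import Data.Integer as ℤ using (ℤ; +_)
open import Data.Fin using (Fin; splitAt; remQuot)
import Data.Fin as Fin
open import Data.Vec using (Vec; []; _∷_; lookup; replicate; zipWith; count)
open import Data.List using (List; []; _∷_; _++_; map; filter; length; foldr; allFin; upTo)
open import Data.Bool.ListAction using (any; all)
open import Data.Sum using (inj₁; inj₂)
open import Data.Product using (Σ; ∃; _×_; _,_)
open import Relation.Nullary.Decidable using (⌊_⌋)
open import Relation.Binary.PropositionalEquality using (_≡_)

record Graph : Set where
  constructor mkGraph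
  field
    order : ℕ
    adj   : Fin order → Fin order → Bool
open Graph public

VSet : ℕ → Set
VSet n = Vec Bool n

_∈ᵇ_ : ∀ {n} → Fin n → VSet n → Bool
v ∈ᵇ X = lookup X v

_==ᶠ_ : ∀ {n} → Fin n → Fin n → Bool
a ==ᶠ b = ⌊ a Fin.≟ b ⌋

∅ˢ : ∀ {n} → VSet n
∅ˢ = replicate _ false

∣_∣ˢ : ∀ {n} → VSet n → ℕ
∣ X ∣ˢ = count (λ b → b Data.Bool.≟ true) X
  where import Data.Bool

_∩ˢ_ : ∀ {n} → VSet n → VSet n → VSet n
_∩ˢ_ = zipWith _∧_

∁ˢ : ∀ {n} → VSet n → VSet n
∁ˢ = Data.Vec.map not

verts : ∀ n → List (Fin n)
verts n = allFin n

_⊆ᵇ_ : ∀ {n} → VSet n → VSet n → Bool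
_⊆ᵇ_ {n} X Y = all (λ v → not (v ∈ᵇ X) ∨ (v ∈ᵇ Y)) (verts n)

_==ˢ_ : ∀ {n} → VSet n → VSet n → Bool
X ==ˢ Y = (X ⊆ᵇ Y) ∧ (Y ⊆ᵇ X)

allSubsets : ∀ n → List (VSet n)
allSubsets zero    = [] ∷ []
allSubsets (suc n) = map (true ∷_) (allSubsets n) ++ map (false ∷_) (allSubsets n)

sublists : ∀ {A : Set} → List A → List (List A)
sublists []       = [] ∷ []
sublists (x ∷ xs) = map (x ∷_) (sublists xs) ++ sublists xs

xwalk : (G : Graph) → VSet (order G) → ℕ → Fin (order G) → Fin (order G) → Bool
xwalk G X zero          u v = u ==ᶠ v
xwalk G X (suc zero)    u v = adj G u v
xwalk G X (suc (suc k)) u v =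
  any (λ w → adj G u w ∧ not (w ∈ᵇ X) ∧ xwalk G X (suc k) w v) (verts (order G))

walk : (G : Graph) → ℕ → Fin (order G) → Fin (order G) → Bool
walk G = xwalk G ∅ˢ

IsSimple : Graph → Set
IsSimple G = (∀ u v → adj G u v ≡ adj G v u) × (∀ u → adj G u u ≡ false)

IsConnected : Graph → Set
IsConnected G = ∀ u v → ∃ λ k → walk G k u v ≡ true

-- Distance d_G(u,v): least length of a (u,v)-walk (searched among
-- lengths 0 .. order-1, which suffices in a connected graph).
dist : (G : Graph) → Fin (order G) → Fin (order G) → ℕ
dist G u v = search (order G) 0
  where
  search : ℕ → ℕ → ℕ
  search zero    k = k
  search (suc f) k = if walk G k u v then k else search f (suc k)

-- Visibility.  u,v are X-visible iff some shortest (u,v)-path (i.e. a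
-- (u,v)-walk of length d_G(u,v)) has no internal vertex in X.

visible : (G : Graph) → VSet (order G) → Fin (order G) → Fin (order G) → Bool
visible G X u v = xwalk G X (dist G u v) u v

setVisible : (G : Graph) → VSet (order G) → VSet (order G) → Bool
setVisible G X Y =
  all (λ u → all (λ v → not (u ∈ᵇ Y) ∨ not (v ∈ᵇ Y) ∨ visible G X u v)
                 (verts (order G)))
      (verts (order G))

isMV : (G : Graph) → VSet (order G) → Bool
isMV G X = setVisible G X X

diamLe : (G : Graph) → ℕ → VSet (order G) → Bool
diamLe G d X =
  all (λ u → all (λ v → not (u ∈ᵇ X) ∨ not (v ∈ᵇ X) ∨ (dist G u v ≤ᵇ d))
                 (verts (order G)))
      (verts (order G))

isCQ : (G : Graph) → VSet (order G) → VSet (order G) → Bool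
isCQ G Q W =
  (W ⊆ᵇ ∁ˢ Q) ∧ setVisible G Q W ∧
  all (λ u → all (λ w → not (u ∈ᵇ Q) ∨ not (w ∈ᵇ W) ∨ visible G Q u w)
                 (verts (order G)))
      (verts (order G))

isAbsCQ : (G : Graph) → VSet (order G) → VSet (order G) → Bool
isAbsCQ G Q W = isCQ G Q W ∧ isMV G Q

isMaxAbsCQ : (G : Graph) → VSet (order G) → VSet (order G) → Bool
isMaxAbsCQ G Q W =
  isAbsCQ G Q W ∧
  all (λ W' → not (W ⊆ᵇ W') ∨ (W' ==ˢ W) ∨ not (isAbsCQ G Q W'))
      (allSubsets (order G))

Γ : (G : Graph) → VSet (order G) → List (VSet (order G))
Γ G Q = filter (λ W → isMaxAbsCQ G Q W Data.Bool.≟ true) (allSubsets (order G))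
  where import Data.Bool

isDisjointVisible : (G : Graph) → VSet (order G) → Bool
isDisjointVisible G Q =
  (length (Γ G Q) ≤ᵇ 1) ∨
  all (λ W → all (λ W' → (W ==ˢ W') ∨ ((W ∩ˢ W') ==ˢ ∅ˢ)) (Γ G Q)) (Γ G Q)

Poly : Set
Poly = ℕ → ℤ

_≈ₚ_ : Poly → Poly → Set
p ≈ₚ q = ∀ i → p i ≡ q i

constₚ : ℤ → Poly
constₚ c zero    = c
constₚ c (suc _) = + 0

1ₚ : Poly
1ₚ = constₚ (+ 1)

0ₚ : Poly
0ₚ = constₚ (+ 0)

xₚ : Poly
xₚ (suc zero) = + 1
xₚ _          = + 0

_+ₚ_ : Poly → Poly → Poly
(p +ₚ q) i = p i ℤ.+ q i

_-ₚ_ : Poly → Poly → Poly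
(p -ₚ q) i = p i ℤ.- q i

_*ₚ_ : Poly → Poly → Poly
(p *ₚ q) i = sumℤ (map (λ j → p j ℤ.* q (i ℕ.∸ j)) (upTo (suc i)))
  where
  sumℤ : List ℤ → ℤ
  sumℤ = foldr ℤ._+_ (+ 0)

_^ₚ_ : Poly → ℕ → Poly
p ^ₚ zero  = 1ₚ
p ^ₚ suc k = p *ₚ (p ^ₚ k)

_·ₚ_ : ℤ → Poly → Poly
(c ·ₚ p) i = c ℤ.* p i

sumₚ : List Poly → Poly
sumₚ = foldr _+ₚ_ 0ₚ

infixl 6 _+ₚ_ _-ₚ_
infixl 7 _*ₚ_ _·ₚ_
infixr 8 _^ₚ_

countᵇ : ∀ {A : Set} → (A → Bool) → List A → ℕ
countᵇ P xs = length (filter (λ a → P a Data.Bool.≟ true) xs)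
  where import Data.Bool

visPoly : Graph → Poly
visPoly G i = + countᵇ (λ X → (∣ X ∣ˢ ≡ᵇ i) ∧ isMV G X) (allSubsets (order G))

visPolyD : ℕ → Graph → Poly
visPolyD d G i =
  + countᵇ (λ X → (∣ X ∣ˢ ≡ᵇ i) ∧ isMV G X ∧ diamLe G d X) (allSubsets (order G))

-- Corona product G ⊙ H on Fin (m + m * n): the first m vertices are
-- V(G); vertex (g , h) of the second block is vertex h of the copy H_g.

corona : Graph → Graph → Graph
corona G H = mkGraph (m ℕ.+ m ℕ.* n) a
  where
  m = order G
  n = order H
  a : Fin (m ℕ.+ m ℕ.* n) → Fin (m ℕ.+ m ℕ.* n) → Bool
  a x y with splitAt m x | splitAt m y
  ... | inj₁ g | inj₁ g' = adj G g g'
  ... | inj₁ g | inj₂ k  with remQuot {m} n k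
  ...   | (g' , _) = g ==ᶠ g'
  a x y | inj₂ k | inj₁ g with remQuot {m} n k
  ...   | (g' , _) = g ==ᶠ g'
  a x y | inj₂ k | inj₂ k' with remQuot {m} n k | remQuot {m} n k'
  ...   | (g , h) | (g' , h') = (g ==ᶠ g') ∧ adj H h h'

⋂ : ∀ {n} → List (VSet n) → VSet n
⋂ = foldr _∩ˢ_ (replicate _ true)

sign : ℕ → ℤ
sign zero    = ℤ.-[1+ 0 ]
sign (suc k) = ℤ.- sign k

pQ : (G : Graph) → ℕ → VSet (order G) → Poly
pQ G n Q =
  if isDisjointVisible G Q
  then sumₚ (map (λ Ω → ((1ₚ +ₚ xₚ) ^ₚ (∣ Ω ∣ˢ ℕ.* n) -ₚ 1ₚ) *ₚ xₚ ^ₚ ∣ Q ∣ˢ) (Γ G Q))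
  else sumₚ (map (λ J → sign (length J) ·ₚ
                        (((1ₚ +ₚ xₚ) ^ₚ (∣ ⋂ J ∣ˢ ℕ.* n) -ₚ 1ₚ) *ₚ xₚ ^ₚ ∣ Q ∣ˢ))
                 (filter (λ J → 1 ℕ.≤? length J) (sublists (Γ G Q))))

admissibleQ : (G : Graph) → VSet (order G) → Bool
admissibleQ G Q = (1 ≤ᵇ ∣ Q ∣ˢ) ∧ (∣ Q ∣ˢ <ᵇ order G) ∧ isMV G Q

{-# OPTIONS --safe #-}
module Submission where

-- Write a vertex set of the corona as S = Q ∪ ⋃ T_v with Q ⊆ V(G) and T_v ⊆ V(H_v), and let W
-- be the set of v with T_v ≠ ∅.  Every path leaving H_v passes through v.  Hence, if W and Q are
-- disjoint, S is a mutual-visibility set exactly when W is absolute c_Q-visible; and if some g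
-- lies in W ∩ Q, then g hides T_g from everything outside H_g ∪ {g}, which forces Q = W = {g},
-- and inside H_g (where all distances are at most 2) T_g must be a mutual-visibility set of H of
-- diameter at most 2.  The second alternative yields m x (V_2(H) - 1).  In the first, W = ∅ gives
-- V(G) and Q = ∅ gives (1+x)^{mn} - 1; for the remaining Q the absolute c_Q-visible sets are the
-- subsets of the maximal ones, and inclusion–exclusion over Γ_Q (a plain sum when its members
-- are disjoint) counts the families T with W ≠ ∅ contained in one of them.

-- Visibility asks for exact distances, and `dist` is a bounded search. Path comparison settles the
-- distances of the corona: collapsing each copy onto its root never lengthens a path, so geodesics
-- between roots are those of `G`, and leaving a copy costs exactly one extra step. Only pairs
-- inside one copy need a separate look. There 2 is the length of the detour through the root,
-- whence the bound in `visPolyD 2`.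
--
-- On the counting side the two branches of `pQ` are treated as one. A weighted family of sets can
-- replace the absolute c_Q-visible sets once, for every non-empty `W`, the weights of the members
-- containing `W` add up to the indicator of `W` being absolute c_Q-visible. Non-emptiness matters:
-- several disjoint maximal sets all contain the empty set, and the `- 1` in each term discards that
-- case. Polynomial identities are proved coefficient by coefficient, as sums of indicators over `Q`
-- and the blocks.

open import Defs
open import Data.Nat using (ℕ; zero; suc; _∸_; _≤_; _<_; z≤n; s≤s; _<?_; _≤ᵇ_; _<ᵇ_; _≡ᵇ_)
import Data.Nat as ℕ
open import Data.Nat.Properties using (≤-refl; ≤-reflexive; ≤-trans; ≤-antisym; ≤-pred; <-irrefl; <-≤-trans; ≤-<-trans; ≮⇒≥; ≰⇒>; n≮0; m∸n≤m; m≤n+m; m≤n⇒m<n∨m≡n; m≤n⇒m≤1+n; ≤⇒≤ᵇ; ≤ᵇ⇒≤; <⇒<ᵇ; +-monoˡ-≤)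
import Data.Nat.Properties as ℕP
open import Data.Integer using (ℤ; +_; _+_; _*_; _-_; -_; 1ℤ)
open import Data.Integer.Properties using (+-identityˡ; +-identityʳ; +-assoc; +-comm; +-inverseʳ; *-identityˡ; *-identityʳ; *-zeroʳ; *-assoc; *-comm; *-distribˡ-+; *-distribʳ-+; -1*i≡-i; neg-distribˡ-*; suc-*)
open import Data.Fin as F using (Fin; zero; suc; toℕ; combine; splitAt; join)
import Data.Fin.Properties as FP
open import Data.List using (List; []; _∷_; _++_; map; filter; length; foldr; cartesianProductWith)
open import Data.List.Properties using (map-applyUpTo)
open import Data.List.Relation.Unary.Any using (here; there)
open import Data.List.Membership.Propositional using (_∈_)
open import Data.List.Membership.Propositional.Properties using (∈-allFin; ∈-++⁺ˡ; ∈-++⁺ʳ; ∈-map⁺; ∈-filter⁺; ∈-filter⁻)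
open import Data.Bool using (Bool; true; false; not; _∧_; _∨_; _≟_)
open import Data.Bool.Properties using (T-≡; ∧-conicalˡ; ∧-conicalʳ)
open import Data.Bool.ListAction using (any; all)
open import Data.Vec as V using (Vec; []; _∷_; lookup; concat)
open import Data.Vec.Properties using (lookup-map; lookup-++ˡ; lookup-++ʳ; lookup-zipWith; lookup-replicate; count≤n)
open import Data.Product using (∃; _×_; _,_; proj₁; proj₂)
open import Data.Sum using (_⊎_; inj₁; inj₂)
open import Data.Empty using (⊥; ⊥-elim)
open import Function using (_∘_; id; Equivalence)
open import Relation.Nullary using (yes; no; ¬_)
open import Relation.Binary.PropositionalEquality
open ≡-Reasoning

-- Boolean predicates

bool-ext : ∀ {a b} → (a ≡ true → b ≡ true) → (b ≡ true → a ≡ true) → a ≡ b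
bool-ext {true}  {_}     f g = sym (f refl)
bool-ext {false} {true}  f g = g refl
bool-ext {false} {false} f g = refl

∧⁺ : ∀ {a b} → a ≡ true → b ≡ true → a ∧ b ≡ true
∧⁺ refl refl = refl

∧⁻ : ∀ {a b} → a ∧ b ≡ true → a ≡ true × b ≡ true
∧⁻ {a} {b} p = ∧-conicalˡ a b p , ∧-conicalʳ a b p

∨⁻ : ∀ {a b} → a ∨ b ≡ true → a ≡ true ⊎ b ≡ true
∨⁻ {true}  p = inj₁ refl
∨⁻ {false} p = inj₂ p

∨⁺ˡ : ∀ {a b} → a ≡ true → a ∨ b ≡ true
∨⁺ˡ refl = refl

∨⁺ʳ : ∀ {a b} → b ≡ true → a ∨ b ≡ true
∨⁺ʳ {true}  p = refl
∨⁺ʳ {false} p = p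

not⁺ : ∀ {a} → a ≡ false → not a ≡ true
not⁺ refl = refl

not⁻ : ∀ {a} → not a ≡ true → a ≡ false
not⁻ {false} p = refl

true≢false : ∀ {a} {A : Set} → a ≡ true → a ≡ false → A
true≢false refl ()

≢true⇒false : ∀ {a} → ¬ (a ≡ true) → a ≡ false
≢true⇒false {true}  p = ⊥-elim (p refl)
≢true⇒false {false} p = refl

implies⁺ : ∀ {a b} → (a ≡ true → b ≡ true) → not a ∨ b ≡ true
implies⁺ {true}  f = f refl
implies⁺ {false} f = refl

implies⁻ : ∀ {a b} → not a ∨ b ≡ true → a ≡ true → b ≡ true
implies⁻ p refl = p

all⁺ : ∀ {A : Set} (p : A → Bool) xs → (∀ x → x ∈ xs → p x ≡ true) → all p xs ≡ true
all⁺ p []       f = refl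
all⁺ p (x ∷ xs) f = ∧⁺ (f x (here refl)) (all⁺ p xs (λ y → f y ∘ there))

all⁻ : ∀ {A : Set} (p : A → Bool) xs → all p xs ≡ true → ∀ {x} → x ∈ xs → p x ≡ true
all⁻ p (x ∷ xs) q (here refl) = proj₁ (∧⁻ q)
all⁻ p (x ∷ xs) q (there i)   = all⁻ p xs (proj₂ (∧⁻ {p x} q)) i

any⁺ : ∀ {A : Set} (p : A → Bool) {xs x} → x ∈ xs → p x ≡ true → any p xs ≡ true
any⁺ p (here refl)     q = ∨⁺ˡ q
any⁺ p {y ∷ _} (there i) q = ∨⁺ʳ {p y} (any⁺ p i q)

any⁻ : ∀ {A : Set} (p : A → Bool) xs → any p xs ≡ true → ∃ λ x → x ∈ xs × p x ≡ true
any⁻ p (x ∷ xs) q with ∨⁻ {p x} q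
... | inj₁ px = x , here refl , px
... | inj₂ q′ with any⁻ p xs q′
...   | y , i , py = y , there i , py

allV⁺ : ∀ {n} (p : Fin n → Bool) → (∀ v → p v ≡ true) → all p (verts n) ≡ true
allV⁺ p f = all⁺ p (verts _) (λ v _ → f v)

allV⁻ : ∀ {n} (p : Fin n → Bool) → all p (verts n) ≡ true → ∀ v → p v ≡ true
allV⁻ {n} p q v = all⁻ p (verts n) q (∈-allFin v)

all₂⁺ : ∀ {n} (p q : Fin n → Bool) (r : Fin n → Fin n → Bool) →
        (∀ u v → p u ≡ true → q v ≡ true → r u v ≡ true) →
        all (λ u → all (λ v → not (p u) ∨ not (q v) ∨ r u v) (verts n)) (verts n) ≡ true
all₂⁺ p q r f = allV⁺ _ λ u → allV⁺ _ λ v → implies⁺ λ pu → implies⁺ λ qv → f u v pu qv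

all₂⁻ : ∀ {n} (p q : Fin n → Bool) (r : Fin n → Fin n → Bool) →
        all (λ u → all (λ v → not (p u) ∨ not (q v) ∨ r u v) (verts n)) (verts n) ≡ true →
        ∀ u v → p u ≡ true → q v ≡ true → r u v ≡ true
all₂⁻ {n} p q r h u v pu qv = implies⁻ (implies⁻ (allV⁻ (φ u) (allV⁻ (λ u → all (φ u) (verts n)) h u) v) pu) qv
  where
  φ : Fin n → Fin n → Bool
  φ u v = not (p u) ∨ not (q v) ∨ r u v

==ᶠ⁻ : ∀ {n} {a b : Fin n} → a ==ᶠ b ≡ true → a ≡ b
==ᶠ⁻ {a = a} {b} p with a F.≟ b
... | yes e = e

==ᶠ⁺ : ∀ {n} (a : Fin n) → a ==ᶠ a ≡ true
==ᶠ⁺ a with a F.≟ a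
... | yes _   = refl
... | no  a≢a = ⊥-elim (a≢a refl)

∅ˢ-∉ : ∀ {n} (v : Fin n) → v ∈ᵇ ∅ˢ ≡ false
∅ˢ-∉ v = lookup-replicate v false

-- Walks and distances

-- The constructors mirror the clauses of `xwalk`. The target of `edge` is an endpoint, so only the
-- vertices entered by `step` are tested against `X`.
data Path (G : Graph) (X : VSet (order G)) : ℕ → Fin (order G) → Fin (order G) → Set where
  nil  : ∀ {u} → Path G X 0 u u
  edge : ∀ {u v} → adj G u v ≡ true → Path G X 1 u v
  step : ∀ {k u w v} → adj G u w ≡ true → w ∈ᵇ X ≡ false →
         Path G X (suc k) w v → Path G X (suc (suc k)) u v

module _ {G : Graph} {X : VSet (order G)} where

  xwalk⁻ : ∀ k {u v} → xwalk G X k u v ≡ true → Path G X k u v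
  xwalk⁻ zero    p with refl ← ==ᶠ⁻ p = nil
  xwalk⁻ (suc k) p = positive k p
    where
    positive : ∀ k {u v} → xwalk G X (suc k) u v ≡ true → Path G X (suc k) u v
    positive zero        p = edge p
    positive (suc k) {u} p with any⁻ _ (verts (order G)) p
    ... | w , _ , q with ∧⁻ {adj G u w} q
    ...   | e , r with ∧⁻ {not (w ∈ᵇ X)} r
    ...     | w∉X , s = step e (not⁻ w∉X) (positive k s)

  xwalk⁺ : ∀ {k u v} → Path G X k u v → xwalk G X k u v ≡ true
  xwalk⁺ nil = ==ᶠ⁺ _
  xwalk⁺ (edge e) = e
  xwalk⁺ (step {w = w} e w∉X p) = any⁺ _ (∈-allFin w) (∧⁺ e (∧⁺ (not⁺ w∉X) (xwalk⁺ p)))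

  cons : ∀ {k u w v} → adj G u w ≡ true → w ∈ᵇ X ≡ false → Path G X k w v → Path G X (suc k) u v
  cons e w∉X nil            = edge e
  cons e w∉X p@(edge _)     = step e w∉X p
  cons e w∉X p@(step _ _ _) = step e w∉X p

  forget : ∀ {k u v} → Path G X k u v → Path G ∅ˢ k u v
  forget nil          = nil
  forget (edge e)     = edge e
  forget (step e x p) = step e (∅ˢ-∉ {order G} _) (forget p)

  snoc : ∀ {k u w v} → Path G X k u w → w ∈ᵇ X ≡ false → adj G w v ≡ true → Path G X (suc k) u v
  snoc nil          x e = edge e
  snoc (edge e′)    x e = step e′ x (edge e)
  snoc (step f y p) x e = step f y (snoc p x e)

  reverse : (∀ u v → adj G u v ≡ adj G v u) → ∀ {k u v} → Path G X k u v → Path G X k v u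
  reverse adj-sym nil          = nil
  reverse adj-sym (edge e)     = edge (trans (adj-sym _ _) e)
  reverse adj-sym (step e x p) = snoc (reverse adj-sym p) x (trans (adj-sym _ _) e)

  private
    vertex : ∀ {k u v} → Path G X k u v → Fin (suc k) → Fin (order G)
    vertex {u = u} p      zero       = u
    vertex {v = v} (edge _) (suc zero) = v
    vertex (step _ _ p)   (suc i)    = vertex p i

    drop : ∀ {k u v} (p : Path G X k u v) i → Path G X (k ∸ toℕ i) (vertex p i) v
    drop p            zero       = p
    drop (edge _)     (suc zero) = nil
    drop (step _ _ p) (suc i)    = drop p i

    -- Continuing from position `j` as soon as position `i` is reached cuts out the closed walk
    -- between them.
    shorten : ∀ {k u v} (p : Path G X k u v) i j → i F.< j → vertex p i ≡ vertex p j →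
              ∃ λ l → l < k × Path G X l u v
    shorten {suc k} p zero (suc j) _ eq =
      k ∸ toℕ j , s≤s (m∸n≤m k (toℕ j)) , subst (λ w → Path G X _ w _) (sym eq) (drop p (suc j))
    shorten (edge _) (suc zero) (suc zero) (s≤s i<j) eq = ⊥-elim (<-irrefl refl i<j)
    shorten (step e x p) (suc i) (suc j) (s≤s i<j) eq with shorten p i j i<j eq
    ... | l , l<k , q = suc l , s≤s l<k , cons e x q

  -- `dist` tries only lengths below `order G`. A longer walk repeats a vertex by the pigeonhole
  -- principle and can be shortened; `b` in `go` bounds the remaining length and makes the descent
  -- terminate.
  shortPath : ∀ {k u v} → Path G X k u v → ∃ λ l → l < order G × Path G X l u v
  shortPath {k} p = go k ≤-refl p
    where
    go : ∀ b {k u v} → k ≤ b → Path G X k u v → ∃ λ l → l < order G × Path G X l u v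
    go b {k} k≤b p with k <? order G
    ... | yes k<n = k , k<n , p
    ... | no  k≮n with FP.pigeonhole (s≤s (≮⇒≥ k≮n)) (vertex p)
    ...   | i , j , i<j , eq with shorten p i j i<j eq
    go zero    k≤b p | no _ | _ | l , l<k , q = ⊥-elim (n≮0 (<-≤-trans l<k k≤b))
    go (suc b) k≤b p | no _ | _ | l , l<k , q = go b (≤-pred (<-≤-trans l<k k≤b)) q

private
  record Vertex (G : Graph) : Set where
    constructor ⟨_⟩
    field at : Fin (order G)
  open Vertex

  -- Unification against the generalised goal recovers the local function
  -- search of dist, which has no name outside Defs.  The wrapper Vertex hides
  -- order G from the with-abstraction.
  mutual
    search : (G : Graph) (u v : Vertex G) → ℕ → ℕ → ℕ
    search = _

    dist≡search : (G : Graph) (u v : Vertex G) → dist G (at u) (at v) ≡ search G u v (order G) 0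
    dist≡search G u v with order G | 0
    ... | n | k = refl

module _ {G : Graph} {u v : Fin (order G)} where

  private
    search-≤ : ∀ n k {j} → k ≤ j → Path G ∅ˢ j u v → search G ⟨ u ⟩ ⟨ v ⟩ n k ≤ j
    search-≤ zero    k k≤j p = k≤j
    search-≤ (suc n) k {j} k≤j p with walk G k u v in eq
    ... | true  = k≤j
    ... | false with m≤n⇒m<n∨m≡n k≤j
    ...   | inj₁ k<j  = search-≤ n (suc k) k<j p
    ...   | inj₂ refl = true≢false (xwalk⁺ p) eq

    -- The bound `j < k + n` ensures that the search succeeds before its fuel runs out; the fallback
    -- value would come without a walk.
    search-path : ∀ n k {j} → k ≤ j → j < k ℕ.+ n → Path G ∅ˢ j u v →
                  Path G ∅ˢ (search G ⟨ u ⟩ ⟨ v ⟩ n k) u v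
    search-path zero    k k≤j j<k p = ⊥-elim (<-irrefl refl (<-≤-trans j<k (≤-trans (≤-reflexive (ℕP.+-identityʳ k)) k≤j)))
    search-path (suc n) k {j} k≤j j<k+n p with walk G k u v in eq
    ... | true  = xwalk⁻ k eq
    ... | false with m≤n⇒m<n∨m≡n k≤j
    ...   | inj₁ k<j  = search-path n (suc k) k<j (≤-trans j<k+n (≤-reflexive (ℕP.+-suc k n))) p
    ...   | inj₂ refl = true≢false (xwalk⁺ p) eq

  dist-≤ : ∀ {j} → Path G ∅ˢ j u v → dist G u v ≤ j
  dist-≤ = search-≤ (order G) 0 z≤n

  dist-path : ∀ {j} → Path G ∅ˢ j u v → Path G ∅ˢ (dist G u v) u v
  dist-path p with shortPath p
  ... | l , l<n , q = search-path (order G) 0 z≤n l<n q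

record Visible (G : Graph) (X : VSet (order G)) (u v : Fin (order G)) : Set where
  constructor along
  field path : Path G X (dist G u v) u v
open Visible public

module _ {G : Graph} where

  connected-path : IsConnected G → ∀ u v → Path G ∅ˢ (dist G u v) u v
  connected-path conn u v with conn u v
  ... | k , p = dist-path (xwalk⁻ k p)

  -- Replaces the evaluation of `dist` by a comparison of lengths: an `X`-avoiding path that no
  -- unrestricted path undercuts is a geodesic.
  visible-minimal : ∀ {X k u v} → Path G X k u v → (∀ {j} → Path G ∅ˢ j u v → k ≤ j) → Visible G X u v
  visible-minimal {X} {k} p minimal =
    along (subst (λ d → Path G X d _ _) (≤-antisym (minimal (dist-path (forget p))) (dist-≤ (forget p))) p)

  visible-refl : ∀ {X} u → Visible G X u u
  visible-refl u = visible-minimal nil (λ _ → z≤n)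

  visible-adj : ∀ {X u v} → u ≢ v → adj G u v ≡ true → Visible G X u v
  visible-adj u≢v e = visible-minimal (edge e) λ where
    nil          → ⊥-elim (u≢v refl)
    (edge _)     → s≤s z≤n
    (step _ _ _) → s≤s z≤n

  visible-sym : (∀ u v → adj G u v ≡ adj G v u) → ∀ {X u v} → Visible G X u v → Visible G X v u
  visible-sym adj-sym (along p) = visible-minimal (reverse adj-sym p) (dist-≤ ∘ reverse adj-sym)

-- Non-empty sets

nonempty : ∀ {n} → VSet n → Bool
nonempty []      = false
nonempty (b ∷ X) = b ∨ nonempty X

nonempty⁺ : ∀ {n} (X : VSet n) v → v ∈ᵇ X ≡ true → nonempty X ≡ true
nonempty⁺ (b ∷ X) zero    p = ∨⁺ˡ p
nonempty⁺ (b ∷ X) (suc v) p = ∨⁺ʳ {b} (nonempty⁺ X v p)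

nonempty⁻ : ∀ {n} (X : VSet n) → nonempty X ≡ true → ∃ λ v → v ∈ᵇ X ≡ true
nonempty⁻ (true  ∷ X) p = zero , refl
nonempty⁻ (false ∷ X) p with nonempty⁻ X p
... | v , q = suc v , q

empty⁻ : ∀ {n} (X : VSet n) → nonempty X ≡ false → ∀ v → v ∈ᵇ X ≡ false
empty⁻ X p v = ≢true⇒false λ q → true≢false (nonempty⁺ X v q) p

empty⁺ : ∀ {n} (X : VSet n) → (∀ v → v ∈ᵇ X ≡ false) → nonempty X ≡ false
empty⁺ X f = ≢true⇒false λ p → let v , q = nonempty⁻ X p in true≢false q (f v)

-- Visibility, propositionally

module _ (G : Graph) (X Y : VSet (order G)) where

  setVisible⁺ : (∀ u v → u ∈ᵇ Y ≡ true → v ∈ᵇ Y ≡ true → Visible G X u v) →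
                setVisible G X Y ≡ true
  setVisible⁺ f = all₂⁺ (_∈ᵇ Y) (_∈ᵇ Y) (visible G X) λ u v u∈Y v∈Y → xwalk⁺ (path (f u v u∈Y v∈Y))

  setVisible⁻ : setVisible G X Y ≡ true →
                ∀ u v → u ∈ᵇ Y ≡ true → v ∈ᵇ Y ≡ true → Visible G X u v
  setVisible⁻ h u v u∈Y v∈Y = along (xwalk⁻ _ (all₂⁻ (_∈ᵇ Y) (_∈ᵇ Y) (visible G X) h u v u∈Y v∈Y))

⊆ᵇ⁺ : ∀ {n} (X Y : VSet n) → (∀ v → v ∈ᵇ X ≡ true → v ∈ᵇ Y ≡ true) → X ⊆ᵇ Y ≡ true
⊆ᵇ⁺ X Y f = allV⁺ _ λ v → implies⁺ (f v)

⊆ᵇ⁻ : ∀ {n} (X Y : VSet n) → X ⊆ᵇ Y ≡ true → ∀ v → v ∈ᵇ X ≡ true → v ∈ᵇ Y ≡ true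
⊆ᵇ⁻ X Y h v = implies⁻ (allV⁻ (λ v → not (v ∈ᵇ X) ∨ (v ∈ᵇ Y)) h v)

record AbsVisible (G : Graph) (Q W : VSet (order G)) : Set where
  field
    disjoint : ∀ w → w ∈ᵇ W ≡ true → w ∈ᵇ Q ≡ false
    within   : ∀ u w → u ∈ᵇ W ≡ true → w ∈ᵇ W ≡ true → Visible G Q u w
    across   : ∀ u w → u ∈ᵇ Q ≡ true → w ∈ᵇ W ≡ true → Visible G Q u w
    internal : ∀ u v → u ∈ᵇ Q ≡ true → v ∈ᵇ Q ≡ true → Visible G Q u v

module _ (G : Graph) (Q W : VSet (order G)) where

  isAbsCQ⁺ : AbsVisible G Q W → isAbsCQ G Q W ≡ true
  isAbsCQ⁺ a = ∧⁺ (∧⁺ (⊆ᵇ⁺ W (∁ˢ Q) λ w w∈W → trans (lookup-map w not Q) (not⁺ (disjoint w w∈W)))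
                      (∧⁺ (setVisible⁺ G Q W within)
                          (all₂⁺ (_∈ᵇ Q) (_∈ᵇ W) (visible G Q) λ u w u∈Q w∈W → xwalk⁺ (path (across u w u∈Q w∈W)))))
                  (setVisible⁺ G Q Q internal)
    where open AbsVisible a

  isAbsCQ⁻ : isAbsCQ G Q W ≡ true → AbsVisible G Q W
  isAbsCQ⁻ h with ∧⁻ {isCQ G Q W} h
  ... | cq , mv with ∧⁻ {W ⊆ᵇ ∁ˢ Q} cq
  ...   | dis , rest with ∧⁻ {setVisible G Q W} rest
  ...     | wi , ac = record
    { disjoint = λ w w∈W → not⁻ (trans (sym (lookup-map w not Q)) (⊆ᵇ⁻ W (∁ˢ Q) dis w w∈W))
    ; within   = setVisible⁻ G Q W wi
    ; across   = λ u w u∈Q w∈W → along (xwalk⁻ _ (all₂⁻ (_∈ᵇ Q) (_∈ᵇ W) (visible G Q) ac u w u∈Q w∈W))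
    ; internal = setVisible⁻ G Q Q mv
    }

-- Sets concentrated on one vertex of `G` and its copy of `H`

centred : ∀ {m n} → (VSet n → Bool) → VSet m → Vec (VSet n) m → Bool
centred c []          []       = false
centred c (true  ∷ Q) (S ∷ Ts) = (c S ∧ nonempty S) ∧ not (nonempty Q) ∧ not (nonempty (V.map nonempty Ts))
centred c (false ∷ Q) (S ∷ Ts) = not (nonempty S) ∧ centred c Q Ts

-- The graph arguments use this form, with the centre named. The recursive `centred` serves the
-- counting, which peels off one vertex of `G` at a time.
record Centred {m n} (c : VSet n → Bool) (Q : VSet m) (Ts : Vec (VSet n) m) : Set where
  field
    centre       : Fin m
    centre∈Q     : centre ∈ᵇ Q ≡ true
    block-good   : c (lookup Ts centre) ≡ true
    block-ne     : nonempty (lookup Ts centre) ≡ true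
    others∉Q     : ∀ g → g ≢ centre → g ∈ᵇ Q ≡ false
    others-empty : ∀ g → g ≢ centre → nonempty (lookup Ts g) ≡ false

module _ {n} {c : VSet n → Bool} where
  open Centred

  centred⁻ : ∀ {m} (Q : VSet m) Ts → centred c Q Ts ≡ true → Centred c Q Ts
  centred⁻ [] [] ()
  centred⁻ (true ∷ Q) (S ∷ Ts) p
    with a , b ← ∧⁻ {c S ∧ nonempty S} p
    with d , e ← ∧⁻ {c S} a
    with f , g ← ∧⁻ {not (nonempty Q)} b = record
    { centre = zero ; centre∈Q = refl ; block-good = d ; block-ne = e
    ; others∉Q = λ { zero z → ⊥-elim (z refl) ; (suc v) _ → empty⁻ Q (not⁻ f) v }
    ; others-empty = λ { zero z → ⊥-elim (z refl)
                       ; (suc v) _ → trans (sym (lookup-map v nonempty Ts)) (empty⁻ (V.map nonempty Ts) (not⁻ g) v) }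
    }
  centred⁻ (false ∷ Q) (S ∷ Ts) p with a , b ← ∧⁻ {not (nonempty S)} p with r ← centred⁻ Q Ts b = record
    { centre = suc (centre r) ; centre∈Q = centre∈Q r ; block-good = block-good r ; block-ne = block-ne r
    ; others∉Q = λ { zero _ → refl ; (suc v) z → others∉Q r v (z ∘ cong suc) }
    ; others-empty = λ { zero _ → not⁻ a ; (suc v) z → others-empty r v (z ∘ cong suc) }
    }

  centred⁺ : ∀ {m} (Q : VSet m) Ts → Centred c Q Ts → centred c Q Ts ≡ true
  centred⁺ [] [] r with () ← centre r
  centred⁺ (true ∷ Q) (S ∷ Ts) r with centre r in eq
  ... | suc v = true≢false refl (others∉Q r zero λ e → FP.0≢1+n (trans e eq))
  ... | zero  = ∧⁺ (∧⁺ (subst (λ v → c (lookup (S ∷ Ts) v) ≡ true) eq (block-good r))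
                       (subst (λ v → nonempty (lookup (S ∷ Ts) v) ≡ true) eq (block-ne r)))
                   (∧⁺ (not⁺ (empty⁺ Q λ v → others∉Q r (suc v) (away v)))
                       (not⁺ (empty⁺ (V.map nonempty Ts) λ v →
                         trans (lookup-map v nonempty Ts) (others-empty r (suc v) (away v)))))
    where
    away : ∀ v → suc v ≢ centre r
    away v e = FP.0≢1+n (sym (trans e eq))
  centred⁺ (false ∷ Q) (S ∷ Ts) r with centre r in eq
  ... | zero  = true≢false (centre∈Q r) (cong (lookup (false ∷ Q)) eq)
  ... | suc v = ∧⁺ (not⁺ (others-empty r zero λ e → FP.0≢1+n (trans e eq)))
                   (centred⁺ Q Ts (record
    { centre = v
    ; centre∈Q     = subst (λ u → u ∈ᵇ (false ∷ Q) ≡ true) eq (centre∈Q r)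
    ; block-good   = subst (λ u → c (lookup (S ∷ Ts) u) ≡ true) eq (block-good r)
    ; block-ne     = subst (λ u → nonempty (lookup (S ∷ Ts) u) ≡ true) eq (block-ne r)
    ; others∉Q     = λ g g≢v → others∉Q r (suc g) (away g g≢v)
    ; others-empty = λ g g≢v → others-empty r (suc g) (away g g≢v)
    }))
    where
    away : ∀ g → g ≢ v → suc g ≢ centre r
    away g g≢v e = g≢v (FP.suc-injective (trans e eq))

-- The corona

==ᶠ-sym : ∀ {n} (a b : Fin n) → a ==ᶠ b ≡ b ==ᶠ a
==ᶠ-sym a b = bool-ext flip′ flip′
  where
  flip′ : ∀ {n} {a b : Fin n} → a ==ᶠ b ≡ true → b ==ᶠ a ≡ true
  flip′ {a = a} p with refl ← ==ᶠ⁻ {a = a} p = ==ᶠ⁺ a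

lookup-concat : ∀ {A : Set} {m n} (xss : Vec (Vec A n) m) i j →
                lookup (concat xss) (combine i j) ≡ lookup (lookup xss i) j
lookup-concat (xs ∷ xss) zero    j = lookup-++ˡ xs (concat xss) j
lookup-concat (xs ∷ xss) (suc i) j = trans (lookup-++ʳ xs (concat xss) (combine i j)) (lookup-concat xss i j)

module Corona (G H : Graph) where

  private
    m = order G
    n = order H
    C = corona G H

  -- Abstract, so that unification treats root and leaf as injective.
  abstract

    root : Fin m → Fin (m ℕ.+ m ℕ.* n)
    root g = g F.↑ˡ (m ℕ.* n)

    leaf : Fin m → Fin n → Fin (m ℕ.+ m ℕ.* n)
    leaf g h = m F.↑ʳ combine g h

  data View : Fin (m ℕ.+ m ℕ.* n) → Set where
    isRoot : ∀ g → View (root g)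
    isLeaf : ∀ g h → View (leaf g h)

  abstract

    view : ∀ x → View x
    view x = subst View (FP.join-splitAt m (m ℕ.* n) x) (viewJoin (splitAt m x))
      where
      viewJoin : ∀ s → View (join m (m ℕ.* n) s)
      viewJoin (inj₁ g) = isRoot g
      viewJoin (inj₂ k) = subst (λ k → View (m F.↑ʳ k)) (FP.combine-remQuot {m} n k) (isLeaf _ _)

    splitRoot : ∀ g → splitAt m (root g) ≡ inj₁ g
    splitRoot g = FP.splitAt-↑ˡ m g (m ℕ.* n)

    splitLeaf : ∀ g h → splitAt m (leaf g h) ≡ inj₂ (combine g h)
    splitLeaf g h = FP.splitAt-↑ʳ m (m ℕ.* n) (combine g h)

    root-injective : ∀ {g g′} → root g ≡ root g′ → g ≡ g′
    root-injective = FP.↑ˡ-injective (m ℕ.* n) _ _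

    leaf-injective : ∀ {g h g′ h′} → leaf g h ≡ leaf g′ h′ → g ≡ g′ × h ≡ h′
    leaf-injective {g} {h} {g′} {h′} e =
      FP.combine-injective g h g′ h′ (FP.↑ʳ-injective m (combine g h) (combine g′ h′) e)

    lookup-root : ∀ (Q : VSet m) (Ts : Vec (VSet n) m) g → root g ∈ᵇ (Q V.++ concat Ts) ≡ g ∈ᵇ Q
    lookup-root Q Ts g = lookup-++ˡ Q (concat Ts) g

    lookup-leaf : ∀ (Q : VSet m) (Ts : Vec (VSet n) m) g h → leaf g h ∈ᵇ (Q V.++ concat Ts) ≡ h ∈ᵇ lookup Ts g
    lookup-leaf Q Ts g h = trans (lookup-++ʳ Q (concat Ts) (combine g h)) (lookup-concat Ts g h)

  root≢leaf : ∀ {g g′ h} → root g ≢ leaf g′ h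
  root≢leaf {g} {g′} {h} e with () ← trans (sym (splitRoot g)) (trans (cong (splitAt m) e) (splitLeaf g′ h))

  adj-rr : ∀ g g′ → adj C (root g) (root g′) ≡ adj G g g′
  adj-rr g g′ rewrite splitRoot g | splitRoot g′ = refl

  adj-rl : ∀ g g′ h → adj C (root g) (leaf g′ h) ≡ g ==ᶠ g′
  adj-rl g g′ h rewrite splitRoot g | splitLeaf g′ h =
    cong (λ p → g ==ᶠ proj₁ p) (FP.remQuot-combine {m} {n} g′ h)

  adj-lr : ∀ g h g′ → adj C (leaf g h) (root g′) ≡ g′ ==ᶠ g
  adj-lr g h g′ rewrite splitLeaf g h | splitRoot g′ =
    cong (λ p → g′ ==ᶠ proj₁ p) (FP.remQuot-combine {m} {n} g h)

  adj-ll : ∀ g h g′ h′ → adj C (leaf g h) (leaf g′ h′) ≡ (g ==ᶠ g′) ∧ adj H h h′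
  adj-ll g h g′ h′ rewrite splitLeaf g h | splitLeaf g′ h′ =
    cong₂ (λ p q → (proj₁ p ==ᶠ proj₁ q) ∧ adj H (proj₂ p) (proj₂ q))
          (FP.remQuot-combine {m} {n} g h) (FP.remQuot-combine {m} {n} g′ h′)

  edge-rl : ∀ {g g′ h} → adj C (root g) (leaf g′ h) ≡ true → g ≡ g′
  edge-rl e = ==ᶠ⁻ (trans (sym (adj-rl _ _ _)) e)

  edge-lr : ∀ {g h g′} → adj C (leaf g h) (root g′) ≡ true → g ≡ g′
  edge-lr e = sym (==ᶠ⁻ (trans (sym (adj-lr _ _ _)) e))

  edge-ll : ∀ {g h g′ h′} → adj C (leaf g h) (leaf g′ h′) ≡ true → g ≡ g′ × adj H h h′ ≡ true
  edge-ll {g} {h} {g′} {h′} e with ∧⁻ {g ==ᶠ g′} (trans (sym (adj-ll g h g′ h′)) e)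
  ... | p , q = ==ᶠ⁻ p , q

  module _ (symG : ∀ u v → adj G u v ≡ adj G v u) (symH : ∀ u v → adj H u v ≡ adj H v u) where

    adj-sym : ∀ x y → adj C x y ≡ adj C y x
    adj-sym x y with view x | view y
    ... | isRoot g   | isRoot g′    = trans (adj-rr g g′) (trans (symG g g′) (sym (adj-rr g′ g)))
    ... | isRoot g   | isLeaf g′ h  = trans (adj-rl g g′ h) (sym (adj-lr g′ h g))
    ... | isLeaf g h | isRoot g′    = trans (adj-lr g h g′) (sym (adj-rl g′ g h))
    ... | isLeaf g h | isLeaf g′ h′ =
      trans (adj-ll g h g′ h′) (trans (cong₂ _∧_ (==ᶠ-sym g g′) (symH h h′)) (sym (adj-ll g′ h′ g h)))

  base : ∀ {x} → View x → Fin m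
  base (isRoot g)   = g
  base (isLeaf g h) = g

  ∅-root : ∀ g → root g ∈ᵇ ∅ˢ {m ℕ.+ m ℕ.* n} ≡ g ∈ᵇ ∅ˢ
  ∅-root g = trans (∅ˢ-∉ (root g)) (sym (∅ˢ-∉ g))

  -- Any `X` with trace `Q` on the roots is allowed: taking both sets empty compares distances, and
  -- `Q V.++ concat Ts` compares visibility.
  module Visibility (Q : VSet m) (X : VSet (m ℕ.+ m ℕ.* n))
                    (X-root : ∀ g → root g ∈ᵇ X ≡ g ∈ᵇ Q) where

    -- Collapsing every copy onto its root erases the edges inside a copy and those between a copy
    -- and its root, and keeps the edges of `G`. Hence the length cannot grow; together with `embed`
    -- this identifies the distances between roots with those of `G`.
    project : ∀ {k x y g′} → Path C X k x y → y ≡ root g′ → (vx : View x) →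
              ∃ λ j → j ≤ k × Path G Q j (base vx) g′
    project nil e (isRoot g)   with refl ← root-injective e = 0 , z≤n , nil
    project nil e (isLeaf g h) = ⊥-elim (root≢leaf (sym e))
    project (edge e) refl (isRoot g)   = 1 , ≤-refl , edge (trans (sym (adj-rr _ _)) e)
    project (edge e) refl (isLeaf g h) with refl ← edge-lr e = 0 , z≤n , nil
    project (step {w = w} e w∉X p) e′ vx with view w
    project (step e w∉X p) e′ (isRoot g) | isRoot w with project p e′ (isRoot w)
    ... | j , j≤k , q = suc j , s≤s j≤k , cons (trans (sym (adj-rr _ _)) e) (trans (sym (X-root w)) w∉X) q
    project (step e w∉X p) e′ (isLeaf g h) | isRoot w with refl ← edge-lr e with project p e′ (isRoot w)
    ... | j , j≤k , q = j , m≤n⇒m≤1+n j≤k , q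
    project (step e w∉X p) e′ (isRoot g) | isLeaf w h′ with refl ← edge-rl e with project p e′ (isLeaf w h′)
    ... | j , j≤k , q = j , m≤n⇒m≤1+n j≤k , q
    project (step e w∉X p) e′ (isLeaf g h) | isLeaf w h′ with refl ← proj₁ (edge-ll e) with project p e′ (isLeaf w h′)
    ... | j , j≤k , q = j , m≤n⇒m≤1+n j≤k , q

    embed : ∀ {k g g′} → Path G Q k g g′ → Path C X k (root g) (root g′)
    embed nil          = nil
    embed (edge e)     = edge (trans (adj-rr _ _) e)
    embed (step e x p) = step (trans (adj-rr _ _) e) (trans (X-root _) x) (embed p)

    -- `root g` separates its copy from the rest of the corona. Since `y` is neither that root nor
    -- in the copy, the root is an interior vertex: it avoids `X`, and the remaining path is
    -- strictly shorter.
    through-root : ∀ {k x y g h} → Path C X k x y → x ≡ leaf g h → y ≢ root g → (∀ h′ → y ≢ leaf g h′) →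
                   root g ∈ᵇ X ≡ false × ∃ λ j → j < k × Path C X j (root g) y
    through-root nil refl y≢r y≢l = ⊥-elim (y≢l _ refl)
    through-root {y = y} (edge e) refl y≢r y≢l with view y
    ... | isRoot g′    with refl ← edge-lr e = ⊥-elim (y≢r refl)
    ... | isLeaf g′ h′ with refl ← proj₁ (edge-ll e) = ⊥-elim (y≢l h′ refl)
    through-root (step {w = w} e w∉X p) refl y≢r y≢l with view w
    ... | isRoot g′    with refl ← edge-lr e = w∉X , _ , ≤-refl , p
    ... | isLeaf g′ h′ with refl ← proj₁ (edge-ll e) with through-root p refl y≢r y≢l
    ...   | x , j , j<k , q = x , j , m≤n⇒m≤1+n j<k , q

  project∅ : ∀ {k x g′} → Path C ∅ˢ k x (root g′) → (vx : View x) →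
             ∃ λ j → j ≤ k × Path G ∅ˢ j (base vx) g′
  project∅ p = Visibility.project ∅ˢ ∅ˢ ∅-root p refl

  -- Visibility in the corona for each kind of pair

  module Blocks (Q : VSet m) (Ts : Vec (VSet n) m) where

    private
      X : VSet (m ℕ.+ m ℕ.* n)
      X = Q V.++ concat Ts

      X-root : ∀ g → root g ∈ᵇ X ≡ g ∈ᵇ Q
      X-root = lookup-root Q Ts

      X-leaf : ∀ g h → leaf g h ∈ᵇ X ≡ h ∈ᵇ lookup Ts g
      X-leaf = lookup-leaf Q Ts

    open Visibility Q X X-root

    rr⁺ : ∀ {g g′} → Visible G Q g g′ → Visible C X (root g) (root g′)
    rr⁺ (along p) = visible-minimal (embed p) λ q → let j , j≤k , r = project∅ q (isRoot _) in ≤-trans (dist-≤ r) j≤k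

    rr⁻ : ∀ {g g′} → Visible C X (root g) (root g′) → Visible G Q g g′
    rr⁻ {g} {g′} (along p) with project p refl (isRoot g)
    ... | j , j≤k , q = along (subst (λ d → Path G Q d g g′) (≤-antisym (≤-trans j≤k C≤G) (dist-≤ (forget q))) q)
      where
      shortest : Path G ∅ˢ (dist G g g′) g g′
      shortest = dist-path (forget q)
      C≤G : dist C (root g) (root g′) ≤ dist G g g′
      C≤G = dist-≤ (Visibility.embed ∅ˢ ∅ˢ ∅-root shortest)

    module _ {g : Fin m} {h : Fin n} {y : Fin (m ℕ.+ m ℕ.* n)} (y≢r : y ≢ root g) (y≢l : ∀ h′ → y ≢ leaf g h′) where

      private
        root-edge : adj C (leaf g h) (root g) ≡ true
        root-edge = trans (adj-lr g h g) (==ᶠ⁺ g)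

        leaf-farther : ∀ {k} → Path C ∅ˢ k (leaf g h) y → dist C (root g) y < k
        leaf-farther p with Visibility.through-root ∅ˢ ∅ˢ ∅-root p refl y≢r y≢l
        ... | _ , j , j<k , q = ≤-<-trans (dist-≤ q) j<k

      leaf-visible⁺ : g ∈ᵇ Q ≡ false → Visible C X (root g) y → Visible C X (leaf g h) y
      leaf-visible⁺ g∉Q (along p) = visible-minimal (cons root-edge (trans (X-root g) g∉Q) p) leaf-farther

      leaf-visible⁻ : Visible C X (leaf g h) y → g ∈ᵇ Q ≡ false × Visible C X (root g) y
      leaf-visible⁻ (along p) with through-root p refl y≢r y≢l
      ... | g∉X , j , j<k , q = trans (sym (X-root g)) g∉X , along
        (subst (λ d → Path C X d (root g) y)
          -- `j` is less than the distance from the leaf, which the edge to the root bounds by one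
          -- more than the distance from the root; so `j` is at most the latter.
          (≤-antisym (≤-pred (≤-trans j<k (dist-≤ (cons root-edge (∅ˢ-∉ (root g)) (dist-path (forget q))))))
                     (dist-≤ (forget q))) q)

    lr⁺ : ∀ {g h g′} → g ≢ g′ → g ∈ᵇ Q ≡ false → Visible G Q g g′ → Visible C X (leaf g h) (root g′)
    lr⁺ g≢g′ g∉Q p = leaf-visible⁺ (g≢g′ ∘ sym ∘ root-injective) (λ _ → root≢leaf) g∉Q (rr⁺ p)

    lr⁻ : ∀ {g h g′} → g ≢ g′ → Visible C X (leaf g h) (root g′) → g ∈ᵇ Q ≡ false × Visible G Q g g′
    lr⁻ g≢g′ p with leaf-visible⁻ (g≢g′ ∘ sym ∘ root-injective) (λ _ → root≢leaf) p
    ... | g∉Q , q = g∉Q , rr⁻ q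

    module _ (symG : ∀ u v → adj G u v ≡ adj G v u) (symH : ∀ u v → adj H u v ≡ adj H v u) where

      private
        symC : ∀ {x y} → Visible C X x y → Visible C X y x
        symC = visible-sym {G = C} (adj-sym symG symH)

      private
        other-leaf : ∀ {g g′ h′} → g ≢ g′ → ∀ h → leaf g′ h′ ≢ leaf g h
        other-leaf g≢g′ h e = g≢g′ (sym (proj₁ (leaf-injective e)))

      -- Each leaf is moved to its root in turn, symmetry exchanging the two ends.
      ll⁺ : ∀ {g h g′ h′} → g ≢ g′ → g ∈ᵇ Q ≡ false → g′ ∈ᵇ Q ≡ false → Visible G Q g g′ →
            Visible C X (leaf g h) (leaf g′ h′)
      ll⁺ g≢g′ g∉Q g′∉Q p =
        leaf-visible⁺ (root≢leaf ∘ sym) (other-leaf g≢g′) g∉Q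
          (symC (lr⁺ (g≢g′ ∘ sym) g′∉Q (visible-sym symG p)))

      ll⁻ : ∀ {g h g′ h′} → g ≢ g′ → Visible C X (leaf g h) (leaf g′ h′) →
            g ∈ᵇ Q ≡ false × g′ ∈ᵇ Q ≡ false × Visible G Q g g′
      ll⁻ {g} {h} {g′} {h′} g≢g′ p = proj₁ at-g , proj₁ at-g′ , visible-sym symG (proj₂ at-g′)
        where
        at-g : g ∈ᵇ Q ≡ false × Visible C X (root g) (leaf g′ h′)
        at-g = leaf-visible⁻ (root≢leaf ∘ sym) (other-leaf g≢g′) p
        at-g′ : g′ ∈ᵇ Q ≡ false × Visible G Q g′ g
        at-g′ = lr⁻ (g≢g′ ∘ sym) (symC (proj₂ at-g))

    copy-embed : ∀ {k} g {h h′} → Path H (lookup Ts g) k h h′ → Path C X k (leaf g h) (leaf g h′)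
    copy-embed g nil          = nil
    copy-embed g (edge e)     = edge (trans (adj-ll _ _ _ _) (∧⁺ (==ᶠ⁺ g) e))
    copy-embed g (step e x p) = step (trans (adj-ll _ _ _ _) (∧⁺ (==ᶠ⁺ g) e)) (trans (X-leaf g _) x) (copy-embed g p)

    detour : ∀ Y g h h′ → root g ∈ᵇ Y ≡ false → Path C Y 2 (leaf g h) (leaf g h′)
    detour Y g h h′ g∉Y = step (trans (adj-lr _ _ _) (==ᶠ⁺ g)) g∉Y (edge (trans (adj-rl _ _ _) (==ᶠ⁺ g)))

    -- At most one step: the path cannot leave the copy.
    copy-short : ∀ {k x y Y g h h′} → k ≤ 1 → Path C Y k x y → x ≡ leaf g h → y ≡ leaf g h′ →
                 Path H ∅ˢ k h h′
    copy-short _ nil e e′ with refl ← proj₂ (leaf-injective (trans (sym e) e′)) = nil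
    copy-short _ (edge e) refl refl = edge (proj₂ (edge-ll e))
    copy-short (s≤s ()) (step _ _ _) _ _

    -- A path of length at most 2 has at most one interior vertex. Next to a leaf over `g` this is
    -- another leaf of the same copy or `root g`, and the root is blocked.
    copy-project : ∀ {k x y g h h′} → k ≤ 2 → g ∈ᵇ Q ≡ true → Path C X k x y → x ≡ leaf g h → y ≡ leaf g h′ →
                   Path H (lookup Ts g) k h h′
    copy-project _ _ nil e e′ with refl ← proj₂ (leaf-injective (trans (sym e) e′)) = nil
    copy-project _ _ (edge e) refl refl = edge (proj₂ (edge-ll e))
    copy-project _ g∈Q (step {w = w} e w∉X (edge e′)) refl refl with view w
    ... | isRoot w′    with refl ← edge-lr e = true≢false g∈Q (trans (sym (X-root w′)) w∉X)
    ... | isLeaf w′ h″ with refl ← proj₁ (edge-ll e) =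
      step (proj₂ (edge-ll e)) (trans (sym (X-leaf w′ h″)) w∉X) (edge (proj₂ (edge-ll e′)))
    copy-project (s≤s (s≤s ())) _ (step _ _ (step _ _ _)) _ _

    -- The origin of the factor `n` in the exponents: while its root is unblocked, a copy imposes no
    -- condition on its own block, because pairs at distance 2 see each other through the root.
    copy-free : ∀ {g h h′} → g ∈ᵇ Q ≡ false → Visible C X (leaf g h) (leaf g h′)
    copy-free {g} {h} {h′} g∉Q = along (by-length (dist-path shortcut) (dist-≤ shortcut))
      where
      shortcut : Path C ∅ˢ 2 (leaf g h) (leaf g h′)
      shortcut = detour ∅ˢ g h h′ (∅ˢ-∉ (root g))
      interior-free : ∀ {k} → k ≤ 1 → Path H ∅ˢ k h h′ → Path H (lookup Ts g) k h h′
      interior-free _ nil      = nil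
      interior-free _ (edge e) = edge e
      interior-free (s≤s ()) (step _ _ _)
      by-length : ∀ {d} → Path C ∅ˢ d (leaf g h) (leaf g h′) → d ≤ 2 → Path C X d (leaf g h) (leaf g h′)
      by-length {0} p _ = copy-embed g (interior-free z≤n (copy-short z≤n p refl refl))
      by-length {1} p _ = copy-embed g (interior-free ≤-refl (copy-short ≤-refl p refl refl))
      by-length {2} p _ = detour X g h h′ (trans (X-root g) g∉Q)
      by-length {suc (suc (suc _))} _ (s≤s (s≤s ()))

    -- A corona geodesic between the two leaves has length at most 2 and, with the root blocked,
    -- stays in the copy. It is therefore a path of `H`, and both distances coincide.
    copy-blocked⁻ : ∀ {g h h′} → g ∈ᵇ Q ≡ true → Visible C X (leaf g h) (leaf g h′) →
                    Visible H (lookup Ts g) h h′ × dist H h h′ ≤ 2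
    copy-blocked⁻ {g} {h} {h′} g∈Q (along p) = along (subst (λ d → Path H (lookup Ts g) d h h′) (sym eq) q) , ≤-trans (≤-reflexive eq) C≤2
      where
      C≤2 : dist C (leaf g h) (leaf g h′) ≤ 2
      C≤2 = dist-≤ (detour ∅ˢ g h h′ (∅ˢ-∉ (root g)))
      q : Path H (lookup Ts g) (dist C (leaf g h) (leaf g h′)) h h′
      q = copy-project C≤2 g∈Q p refl refl
      H≤C : dist H h h′ ≤ dist C (leaf g h) (leaf g h′)
      H≤C = dist-≤ (forget q)
      C≤ : ∀ {d} → Path H ∅ˢ d h h′ → dist C (leaf g h) (leaf g h′) ≤ d
      C≤ nil          = dist-≤ {C} {leaf g h} {leaf g h} nil
      C≤ (edge e)     = dist-≤ {C} {leaf g h} {leaf g h′} (edge (trans (adj-ll g h g h′) (∧⁺ (==ᶠ⁺ g) e)))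
      C≤ (step _ _ _) = ≤-trans C≤2 (s≤s (s≤s z≤n))
      eq : dist H h h′ ≡ dist C (leaf g h) (leaf g h′)
      eq = ≤-antisym H≤C (C≤ (dist-path (forget q)))

    -- Beyond distance 2 in `H` the detour through the root would be strictly shorter, and an
    -- `H`-geodesic would no longer be one in the corona.
    copy-blocked⁺ : ∀ {g h h′} → Visible H (lookup Ts g) h h′ → dist H h h′ ≤ 2 →
                    Visible C X (leaf g h) (leaf g h′)
    copy-blocked⁺ {g} {h} {h′} (along p) d≤2 = visible-minimal (copy-embed g p) minimal
      where
      minimal : ∀ {j} → Path C ∅ˢ j (leaf g h) (leaf g h′) → dist H h h′ ≤ j
      minimal {zero}        q = dist-≤ (copy-short z≤n q refl refl)
      minimal {suc zero}    q = dist-≤ (copy-short ≤-refl q refl refl)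
      minimal {suc (suc j)} q = ≤-trans d≤2 (s≤s (s≤s z≤n))

  -- Mutual-visibility sets of the corona in terms of `Q` and `Ts`

  blockOK : VSet n → Bool
  blockOK S = isMV H S ∧ diamLe H 2 S

  module Characterisation (symG : ∀ u v → adj G u v ≡ adj G v u) (symH : ∀ u v → adj H u v ≡ adj H v u)
           (Q : VSet m) (Ts : Vec (VSet n) m) where

    open Blocks Q Ts

    private
      X : VSet (m ℕ.+ m ℕ.* n)
      X = Q V.++ concat Ts

      X-root : ∀ g → root g ∈ᵇ X ≡ g ∈ᵇ Q
      X-root = lookup-root Q Ts

      X-leaf : ∀ g h → leaf g h ∈ᵇ X ≡ h ∈ᵇ lookup Ts g
      X-leaf = lookup-leaf Q Ts

      W : VSet m
      W = V.map nonempty Ts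

      W⁺ : ∀ {g h} → leaf g h ∈ᵇ X ≡ true → g ∈ᵇ W ≡ true
      W⁺ {g} {h} p = trans (lookup-map g nonempty Ts) (nonempty⁺ (lookup Ts g) h (trans (sym (X-leaf g h)) p))

      W⁻ : ∀ {g} → g ∈ᵇ W ≡ true → ∃ λ h → leaf g h ∈ᵇ X ≡ true
      W⁻ {g} p with nonempty⁻ (lookup Ts g) (trans (sym (lookup-map g nonempty Ts)) p)
      ... | h , q = h , trans (X-leaf g h) q

      ∈X : ∀ {g} → g ∈ᵇ Q ≡ true → root g ∈ᵇ X ≡ true
      ∈X = trans (X-root _)

      symC : ∀ {x y} → Visible C X x y → Visible C X y x
      symC = visible-sym {G = C} (adj-sym symG symH)

    mv⇒abs⊎centred : isMV C X ≡ true → isAbsCQ G Q W ≡ true ⊎ centred blockOK Q Ts ≡ true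
    mv⇒abs⊎centred mv with FP.any? (λ g → (g ∈ᵇ Q ∧ g ∈ᵇ W) ≟ true)
    ... | yes (g , p) with g∈Q , g∈W ← ∧⁻ {g ∈ᵇ Q} p with h , gh∈X ← W⁻ g∈W = inj₂ (centred⁺ Q Ts record
      { centre = g
      ; centre∈Q = g∈Q
      ; block-good = ∧⁺ (setVisible⁺ H (lookup Ts g) (lookup Ts g) λ u v u∈ v∈ → proj₁ (vis u v u∈ v∈))
                        (all₂⁺ (_∈ᵇ lookup Ts g) (_∈ᵇ lookup Ts g) (λ u v → dist H u v ≤ᵇ 2) λ u v u∈ v∈ → Equivalence.to T-≡ (≤⇒≤ᵇ (proj₂ (vis u v u∈ v∈))))
      ; block-ne = trans (sym (lookup-map g nonempty Ts)) g∈W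
      ; others∉Q = λ g′ g′≢g → ≢true⇒false λ g′∈Q →
          true≢false g∈Q (proj₁ (lr⁻ (g′≢g ∘ sym) (all-vis _ _ gh∈X (∈X g′∈Q))))
      ; others-empty = λ g′ g′≢g → ≢true⇒false λ ne →
          let h′ , g′h′∈X = W⁻ (trans (lookup-map g′ nonempty Ts) ne) in
          true≢false g∈Q (proj₁ (ll⁻ symG symH (g′≢g ∘ sym) (all-vis _ _ gh∈X g′h′∈X)))
      })
      where
      all-vis : ∀ x y → x ∈ᵇ X ≡ true → y ∈ᵇ X ≡ true → Visible C X x y
      all-vis = setVisible⁻ C X X mv
      vis : ∀ u v → u ∈ᵇ lookup Ts g ≡ true → v ∈ᵇ lookup Ts g ≡ true →
            Visible H (lookup Ts g) u v × dist H u v ≤ 2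
      vis u v u∈ v∈ = copy-blocked⁻ g∈Q (all-vis _ _ (trans (X-leaf g u) u∈) (trans (X-leaf g v) v∈))
    ... | no ∄ = inj₁ (isAbsCQ⁺ G Q W record
      { disjoint = dis
      ; within = λ u w u∈W w∈W → within u w u∈W w∈W
      ; across = λ u w u∈Q w∈W → let h , wh∈X = W⁻ w∈W in
          visible-sym symG (proj₂ (lr⁻ (λ { refl → true≢false u∈Q (dis _ w∈W) }) (all-vis _ _ wh∈X (∈X u∈Q))))
      ; internal = λ u v u∈Q v∈Q → rr⁻ (all-vis _ _ (∈X u∈Q) (∈X v∈Q))
      })
      where
      all-vis : ∀ x y → x ∈ᵇ X ≡ true → y ∈ᵇ X ≡ true → Visible C X x y
      all-vis = setVisible⁻ C X X mv
      dis : ∀ w → w ∈ᵇ W ≡ true → w ∈ᵇ Q ≡ false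
      dis w w∈W = ≢true⇒false λ w∈Q → ∄ (w , ∧⁺ w∈Q w∈W)
      within : ∀ u w → u ∈ᵇ W ≡ true → w ∈ᵇ W ≡ true → Visible G Q u w
      within u w u∈W w∈W with u F.≟ w
      ... | yes refl = visible-refl u
      ... | no u≢w = let h , uh∈X = W⁻ u∈W ; h′ , wh′∈X = W⁻ w∈W in
        proj₂ (proj₂ (ll⁻ symG symH u≢w (all-vis _ _ uh∈X wh′∈X)))

    abs⇒mv : isAbsCQ G Q W ≡ true → isMV C X ≡ true
    abs⇒mv abs = setVisible⁺ C X X vis
      where
      open AbsVisible (isAbsCQ⁻ G Q W abs)
      vis : ∀ x y → x ∈ᵇ X ≡ true → y ∈ᵇ X ≡ true → Visible C X x y
      leaf-root : ∀ g h g′ → leaf g h ∈ᵇ X ≡ true → root g′ ∈ᵇ X ≡ true → Visible C X (leaf g h) (root g′)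
      leaf-root g h g′ x∈ y∈ = lr⁺ (λ { refl → true≢false g′∈Q (disjoint _ (W⁺ x∈)) }) (disjoint _ (W⁺ x∈))
        (visible-sym symG (across g′ g g′∈Q (W⁺ x∈)))
        where
        g′∈Q = trans (sym (X-root g′)) y∈
      vis x y x∈ y∈ with view x | view y
      ... | isRoot g   | isRoot g′   = rr⁺ (internal g g′ (trans (sym (X-root g)) x∈) (trans (sym (X-root g′)) y∈))
      ... | isLeaf g h | isRoot g′   = leaf-root g h g′ x∈ y∈
      ... | isRoot g   | isLeaf g′ h = symC (leaf-root g′ h g y∈ x∈)
      ... | isLeaf g h | isLeaf g′ h′ with g F.≟ g′
      ...   | yes refl = copy-free (disjoint g (W⁺ x∈))
      ...   | no g≢g′  = ll⁺ symG symH g≢g′ (disjoint g (W⁺ x∈)) (disjoint g′ (W⁺ y∈)) (within g g′ (W⁺ x∈) (W⁺ y∈))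

    centred⇒mv : centred blockOK Q Ts ≡ true → isMV C X ≡ true
    centred⇒mv cen = setVisible⁺ C X X vis
      where
      open Centred (centred⁻ Q Ts cen)
      root-centre : ∀ {g} → root g ∈ᵇ X ≡ true → g ≡ centre
      root-centre {g} x∈ with g F.≟ centre
      ... | yes e  = e
      ... | no g≢c = true≢false (trans (sym (X-root g)) x∈) (others∉Q g g≢c)
      leaf-centre : ∀ {g h} → leaf g h ∈ᵇ X ≡ true → g ≡ centre
      leaf-centre {g} {h} x∈ with g F.≟ centre
      ... | yes e  = e
      ... | no g≢c = true≢false (nonempty⁺ (lookup Ts g) h (trans (sym (X-leaf g h)) x∈)) (others-empty g g≢c)
      vis : ∀ x y → x ∈ᵇ X ≡ true → y ∈ᵇ X ≡ true → Visible C X x y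
      vis x y x∈ y∈ with view x | view y
      ... | isRoot g   | isRoot g′
        with refl ← root-centre x∈ with refl ← root-centre y∈ = visible-refl _
      ... | isLeaf g h | isRoot g′
        with refl ← leaf-centre x∈ with refl ← root-centre y∈ =
          visible-adj (root≢leaf ∘ sym) (trans (adj-lr _ _ _) (==ᶠ⁺ _))
      ... | isRoot g   | isLeaf g′ h
        with refl ← root-centre x∈ with refl ← leaf-centre y∈ =
          visible-adj root≢leaf (trans (adj-rl _ _ _) (==ᶠ⁺ _))
      ... | isLeaf g h | isLeaf g′ h′
        with refl ← leaf-centre x∈ with refl ← leaf-centre y∈ =
          copy-blocked⁺ (setVisible⁻ H S S (proj₁ ok) h h′ h∈ h′∈)
                        (≤ᵇ⇒≤ _ 2 (Equivalence.from T-≡ (all₂⁻ (_∈ᵇ S) (_∈ᵇ S) (λ u v → dist H u v ≤ᵇ 2) (proj₂ ok) h h′ h∈ h′∈)))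
        where
        S = lookup Ts centre
        ok = ∧⁻ {isMV H (lookup Ts centre)} block-good
        h∈ = trans (sym (X-leaf centre h)) x∈
        h′∈ = trans (sym (X-leaf centre h′)) y∈

    -- Makes the two alternatives exclusive, so that their indicators simply add in `ι-isMV`.
    abs∧centred-absurd : isAbsCQ G Q W ≡ true → centred blockOK Q Ts ≡ true → ⊥
    abs∧centred-absurd abs cen =
      true≢false centre∈Q (AbsVisible.disjoint (isAbsCQ⁻ G Q W abs) centre
        (trans (lookup-map centre nonempty Ts) block-ne))
      where open Centred (centred⁻ Q Ts cen)

-- Finite sums of integers

ι : Bool → ℤ
ι true  = + 1
ι false = + 0

ι-∧ : ∀ a b → ι (a ∧ b) ≡ ι a * ι b
ι-∧ true  b = sym (*-identityˡ (ι b))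
ι-∧ false b = refl

∑ : ∀ {A : Set} → List A → (A → ℤ) → ℤ
∑ []       f = + 0
∑ (x ∷ xs) f = f x + ∑ xs f

module _ {A : Set} where

  ∑-cong-∈ : ∀ {f g : A → ℤ} xs → (∀ x → x ∈ xs → f x ≡ g x) → ∑ xs f ≡ ∑ xs g
  ∑-cong-∈ []       f≗g = refl
  ∑-cong-∈ (x ∷ xs) f≗g = cong₂ _+_ (f≗g x (here refl)) (∑-cong-∈ xs (λ y → f≗g y ∘ there))

  ∑-cong : ∀ {f g : A → ℤ} xs → (∀ x → f x ≡ g x) → ∑ xs f ≡ ∑ xs g
  ∑-cong xs f≗g = ∑-cong-∈ xs (λ x _ → f≗g x)

  ∑-zero : ∀ (xs : List A) → ∑ xs (λ _ → + 0) ≡ + 0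
  ∑-zero []       = refl
  ∑-zero (x ∷ xs) = trans (+-identityˡ _) (∑-zero xs)

  ∑-+ : ∀ (f g : A → ℤ) xs → ∑ xs (λ x → f x + g x) ≡ ∑ xs f + ∑ xs g
  ∑-+ f g []       = refl
  ∑-+ f g (x ∷ xs) = begin
    f x + g x + ∑ xs (λ x → f x + g x)   ≡⟨ cong (_+_ (f x + g x)) (∑-+ f g xs) ⟩
    f x + g x + (∑ xs f + ∑ xs g)        ≡⟨ +-assoc (f x) (g x) _ ⟩
    f x + (g x + (∑ xs f + ∑ xs g))      ≡⟨ cong (_+_ (f x)) (+-assoc (g x) (∑ xs f) _) ⟨
    f x + (g x + ∑ xs f + ∑ xs g)        ≡⟨ cong (λ z → f x + (z + ∑ xs g)) (+-comm (g x) _) ⟩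
    f x + (∑ xs f + g x + ∑ xs g)        ≡⟨ cong (_+_ (f x)) (+-assoc (∑ xs f) (g x) _) ⟩
    f x + (∑ xs f + (g x + ∑ xs g))      ≡⟨ +-assoc (f x) (∑ xs f) _ ⟨
    f x + ∑ xs f + (g x + ∑ xs g)        ∎

  ∑-*ˡ : ∀ c (f : A → ℤ) xs → ∑ xs (λ x → c * f x) ≡ c * ∑ xs f
  ∑-*ˡ c f []       = sym (*-zeroʳ c)
  ∑-*ˡ c f (x ∷ xs) = trans (cong (_+_ (c * f x)) (∑-*ˡ c f xs)) (sym (*-distribˡ-+ c (f x) _))

  ∑-minus : ∀ (f g : A → ℤ) xs → ∑ xs (λ x → f x - g x) ≡ ∑ xs f - ∑ xs g
  ∑-minus f g xs = begin
    ∑ xs (λ x → f x - g x)             ≡⟨ ∑-+ f (-_ ∘ g) xs ⟩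
    ∑ xs f + ∑ xs (λ x → - g x)        ≡⟨ cong (_+_ (∑ xs f)) (∑-cong xs λ x → sym (-1*i≡-i (g x))) ⟩
    ∑ xs f + ∑ xs (λ x → - 1ℤ * g x)   ≡⟨ cong (_+_ (∑ xs f)) (∑-*ˡ (- 1ℤ) g xs) ⟩
    ∑ xs f + - 1ℤ * ∑ xs g             ≡⟨ cong (_+_ (∑ xs f)) (-1*i≡-i _) ⟩
    ∑ xs f - ∑ xs g                    ∎

  ∑-++ : ∀ (f : A → ℤ) xs ys → ∑ (xs ++ ys) f ≡ ∑ xs f + ∑ ys f
  ∑-++ f []       ys = sym (+-identityˡ _)
  ∑-++ f (x ∷ xs) ys = trans (cong (_+_ (f x)) (∑-++ f xs ys)) (sym (+-assoc (f x) _ _))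

  ∑-filter : ∀ (P : A → Bool) (f : A → ℤ) xs →
             ∑ (filter (λ x → P x ≟ true) xs) f ≡ ∑ xs (λ x → ι (P x) * f x)
  ∑-filter P f []       = refl
  ∑-filter P f (x ∷ xs) with P x
  ... | true  = cong₂ _+_ (sym (*-identityˡ (f x))) (∑-filter P f xs)
  ... | false = trans (∑-filter P f xs) (sym (+-identityˡ _))

  countᵇ-∑ : ∀ (P : A → Bool) xs → + countᵇ P xs ≡ ∑ xs (ι ∘ P)
  countᵇ-∑ P []       = refl
  countᵇ-∑ P (x ∷ xs) with P x
  ... | true  = cong (λ z → + 1 + z) (countᵇ-∑ P xs)
  ... | false = trans (countᵇ-∑ P xs) (sym (+-identityˡ _))

∑-map : ∀ {A B : Set} (h : A → B) (f : B → ℤ) xs → ∑ (map h xs) f ≡ ∑ xs (f ∘ h)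
∑-map h f []       = refl
∑-map h f (x ∷ xs) = cong (_+_ (f (h x))) (∑-map h f xs)

∑-swap : ∀ {A B : Set} (f : A → B → ℤ) xs ys →
         ∑ xs (λ x → ∑ ys (f x)) ≡ ∑ ys (λ y → ∑ xs (λ x → f x y))
∑-swap f []       ys = sym (∑-zero ys)
∑-swap f (x ∷ xs) ys = trans (cong (_+_ (∑ ys (f x))) (∑-swap f xs ys))
                             (sym (∑-+ (f x) (λ y → ∑ xs (λ x → f x y)) ys))

∑-cartesian : ∀ {A B C : Set} (h : A → B → C) (f : C → ℤ) xs ys →
              ∑ (cartesianProductWith h xs ys) f ≡ ∑ xs (λ x → ∑ ys (λ y → f (h x y)))
∑-cartesian h f []       ys = refl
∑-cartesian h f (x ∷ xs) ys = trans (∑-++ f (map (h x) ys) _)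
                                    (cong₂ _+_ (∑-map (h x) f ys) (∑-cartesian h f xs ys))

-- Sums over subsets and over families of blocks

∣++∣ : ∀ {m n} (X : VSet m) (Y : VSet n) → ∣ X V.++ Y ∣ˢ ≡ ∣ X ∣ˢ ℕ.+ ∣ Y ∣ˢ
∣++∣ []          Y = refl
∣++∣ (true  ∷ X) Y = cong suc (∣++∣ X Y)
∣++∣ (false ∷ X) Y = ∣++∣ X Y

∣∅∣ : ∀ n → ∣ ∅ˢ {n} ∣ˢ ≡ 0
∣∅∣ zero    = refl
∣∅∣ (suc n) = ∣∅∣ n

empty⇒∣∣≡0 : ∀ {n} (X : VSet n) → nonempty X ≡ false → ∣ X ∣ˢ ≡ 0
empty⇒∣∣≡0 []          p = refl
empty⇒∣∣≡0 (false ∷ X) p = empty⇒∣∣≡0 X p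

∑-subsets-suc : ∀ n (f : VSet (suc n) → ℤ) →
                ∑ (allSubsets (suc n)) f ≡ ∑ (allSubsets n) (f ∘ (true ∷_)) + ∑ (allSubsets n) (f ∘ (false ∷_))
∑-subsets-suc n f = trans (∑-++ f (map (true ∷_) (allSubsets n)) _)
                          (cong₂ _+_ (∑-map (true ∷_) f (allSubsets n)) (∑-map (false ∷_) f (allSubsets n)))

∑-subsets-++ : ∀ m n (f : VSet (m ℕ.+ n) → ℤ) →
               ∑ (allSubsets (m ℕ.+ n)) f ≡ ∑ (allSubsets m) (λ X → ∑ (allSubsets n) (λ Y → f (X V.++ Y)))
∑-subsets-++ zero    n f = sym (+-identityʳ _)
∑-subsets-++ (suc m) n f = begin
  ∑ (allSubsets (suc m ℕ.+ n)) f
    ≡⟨ ∑-subsets-suc (m ℕ.+ n) f ⟩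
  ∑ (allSubsets (m ℕ.+ n)) (f ∘ (true ∷_)) + ∑ (allSubsets (m ℕ.+ n)) (f ∘ (false ∷_))
    ≡⟨ cong₂ _+_ (∑-subsets-++ m n _) (∑-subsets-++ m n _) ⟩
  ∑ (allSubsets m) (λ X → ∑ (allSubsets n) (λ Y → f (true ∷ X V.++ Y)))
    + ∑ (allSubsets m) (λ X → ∑ (allSubsets n) (λ Y → f (false ∷ X V.++ Y)))
    ≡⟨ ∑-subsets-suc m _ ⟨
  ∑ (allSubsets (suc m)) (λ X → ∑ (allSubsets n) (λ Y → f (X V.++ Y))) ∎

blocks : ∀ m n → List (Vec (VSet n) m)
blocks zero    n = [] ∷ []
blocks (suc m) n = cartesianProductWith _∷_ (allSubsets n) (blocks m n)

∑-blocks-suc : ∀ m n (f : Vec (VSet n) (suc m) → ℤ) →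
               ∑ (blocks (suc m) n) f ≡ ∑ (allSubsets n) (λ S → ∑ (blocks m n) (λ Ts → f (S ∷ Ts)))
∑-blocks-suc m n f = ∑-cartesian _∷_ f (allSubsets n) (blocks m n)

∑-concat : ∀ m n (f : VSet (m ℕ.* n) → ℤ) → ∑ (allSubsets (m ℕ.* n)) f ≡ ∑ (blocks m n) (f ∘ concat)
∑-concat zero    n f = refl
∑-concat (suc m) n f = begin
  ∑ (allSubsets (n ℕ.+ m ℕ.* n)) f
    ≡⟨ ∑-subsets-++ n (m ℕ.* n) f ⟩
  ∑ (allSubsets n) (λ S → ∑ (allSubsets (m ℕ.* n)) (λ Y → f (S V.++ Y)))
    ≡⟨ ∑-cong (allSubsets n) (λ S → ∑-concat m n (λ Y → f (S V.++ Y))) ⟩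
  ∑ (allSubsets n) (λ S → ∑ (blocks m n) (λ Ts → f (concat (S ∷ Ts))))
    ≡⟨ ∑-blocks-suc m n (f ∘ concat) ⟨
  ∑ (blocks (suc m) n) (f ∘ concat) ∎

support : ∀ {m n} → Vec (VSet n) m → VSet m
support = V.map nonempty

size : ∀ {m n} → Vec (VSet n) m → ℕ
size Ts = ∣ concat Ts ∣ˢ

size-∷ : ∀ {m n} (S : VSet n) (Ts : Vec (VSet n) m) → size (S ∷ Ts) ≡ ∣ S ∣ˢ ℕ.+ size Ts
size-∷ S Ts = ∣++∣ S (concat Ts)

-- f is an arbitrary test function of the cardinality, so that products of generating
-- functions become iterated sums; the choice f = δ i extracts the coefficient of x^i.
∑ˢ : ℕ → (ℕ → ℤ) → ℤ
∑ˢ k f = ∑ (allSubsets k) (λ T → f ∣ T ∣ˢ)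

∑ˢ-+ : ∀ a b f → ∑ˢ (a ℕ.+ b) f ≡ ∑ (allSubsets a) (λ S → ∑ˢ b (λ j → f (∣ S ∣ˢ ℕ.+ j)))
∑ˢ-+ a b f = trans (∑-subsets-++ a b _)
  (∑-cong (allSubsets a) λ X → ∑-cong (allSubsets b) λ Y → cong f (∣++∣ X Y))

∑-empty : ∀ n (f : VSet n → ℤ) → ∑ (allSubsets n) (λ S → ι (not (nonempty S)) * f S) ≡ f ∅ˢ
∑-empty zero    f = trans (+-identityʳ _) (*-identityˡ _)
∑-empty (suc n) f = begin
  ∑ (allSubsets (suc n)) (λ S → ι (not (nonempty S)) * f S)
    ≡⟨ ∑-subsets-suc n _ ⟩
  ∑ (allSubsets n) (λ _ → + 0) + ∑ (allSubsets n) (λ S → ι (not (nonempty S)) * f (false ∷ S))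
    ≡⟨ cong₂ _+_ (∑-zero (allSubsets n)) (∑-empty n (f ∘ (false ∷_))) ⟩
  + 0 + f ∅ˢ
    ≡⟨ +-identityˡ _ ⟩
  f ∅ˢ ∎

⊆ᵇ-∷ : ∀ {m} a b (X Y : VSet m) → (a ∷ X) ⊆ᵇ (b ∷ Y) ≡ (not a ∨ b) ∧ (X ⊆ᵇ Y)
⊆ᵇ-∷ a b X Y = bool-ext
  (λ p → ∧⁺ (implies⁺ (⊆ᵇ⁻ (a ∷ X) (b ∷ Y) p zero)) (⊆ᵇ⁺ X Y (λ v → ⊆ᵇ⁻ (a ∷ X) (b ∷ Y) p (suc v))))
  (λ p → let p₁ , p₂ = ∧⁻ {not a ∨ b} p in
         ⊆ᵇ⁺ (a ∷ X) (b ∷ Y) λ { zero → implies⁻ p₁ ; (suc v) → ⊆ᵇ⁻ X Y p₂ v })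

module _ (n : ℕ) where

  ∑-blocks-∧ : ∀ m (p : VSet n → Bool) (q : Vec (VSet n) m → Bool) (f : ℕ → ℤ) →
    ∑ (allSubsets n) (λ S → ∑ (blocks m n) (λ Ts → ι (p S ∧ q Ts) * f (size (S ∷ Ts)))) ≡
    ∑ (allSubsets n) (λ S → ι (p S) * ∑ (blocks m n) (λ Ts → ι (q Ts) * f (∣ S ∣ˢ ℕ.+ size Ts)))
  ∑-blocks-∧ m p q f = ∑-cong (allSubsets n) λ S →
    trans (∑-cong (blocks m n) λ Ts →
             trans (cong₂ _*_ (ι-∧ (p S) (q Ts)) (cong f (size-∷ S Ts))) (*-assoc (ι (p S)) _ _))
          (∑-*ˡ (ι (p S)) _ (blocks m n))

  ∑-first-empty : ∀ m (q : Vec (VSet n) m → Bool) (f : ℕ → ℤ) →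
    ∑ (allSubsets n) (λ S → ∑ (blocks m n) (λ Ts → ι (not (nonempty S) ∧ q Ts) * f (size (S ∷ Ts)))) ≡
    ∑ (blocks m n) (λ Ts → ι (q Ts) * f (size Ts))
  ∑-first-empty m q f = begin
    _ ≡⟨ ∑-blocks-∧ m (not ∘ nonempty) q f ⟩
    _ ≡⟨ ∑-empty n (λ S → ∑ (blocks m n) (λ Ts → ι (q Ts) * f (∣ S ∣ˢ ℕ.+ size Ts))) ⟩
    ∑ (blocks m n) (λ Ts → ι (q Ts) * f (∣ ∅ˢ {n} ∣ˢ ℕ.+ size Ts))
      ≡⟨ ∑-cong (blocks m n) (λ Ts → cong (λ k → ι (q Ts) * f (k ℕ.+ size Ts)) (∣∅∣ n)) ⟩
    ∑ (blocks m n) (λ Ts → ι (q Ts) * f (size Ts)) ∎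

  ∑-blocks-empty : ∀ m (f : ℕ → ℤ) →
    ∑ (blocks m n) (λ Ts → ι (not (nonempty (support Ts))) * f (size Ts)) ≡ f 0
  ∑-blocks-empty zero    f = trans (+-identityʳ _) (*-identityˡ _)
  ∑-blocks-empty (suc m) f = begin
    _ ≡⟨ ∑-blocks-suc m n _ ⟩
    _ ≡⟨ ∑-cong (allSubsets n) (λ S → ∑-cong (blocks m n) λ Ts →
           cong (λ b → ι b * f (size (S ∷ Ts))) (not-∨ (nonempty S) (nonempty (support Ts)))) ⟩
    _ ≡⟨ ∑-first-empty m (λ Ts → not (nonempty (support Ts))) f ⟩
    _ ≡⟨ ∑-blocks-empty m f ⟩
    f 0 ∎
    where
    not-∨ : ∀ a b → not (a ∨ b) ≡ not a ∧ not b
    not-∨ true  b = refl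
    not-∨ false b = refl

  -- Over a vertex of `Ω` the block is an arbitrary subset of `H`, elsewhere it is empty. The
  -- families thus behave like the subsets of a set with |Ω| n elements, with generating function
  -- (1+x)^(|Ω| n).
  ∑-support-⊆ : ∀ {m} (Ω : VSet m) (f : ℕ → ℤ) →
    ∑ (blocks m n) (λ Ts → ι (support Ts ⊆ᵇ Ω) * f (size Ts)) ≡ ∑ˢ (∣ Ω ∣ˢ ℕ.* n) f
  ∑-support-⊆ [] f = cong (_+ + 0) (*-identityˡ (f 0))
  ∑-support-⊆ {suc m} (true ∷ Ω) f = begin
    _ ≡⟨ ∑-blocks-suc m n _ ⟩
    _ ≡⟨ ∑-cong (allSubsets n) (λ S → ∑-cong (blocks m n) λ Ts → cong₂ (λ b k → ι b * f k)
           (trans (⊆ᵇ-∷ (nonempty S) true (support Ts) Ω) (cong (_∧ (support Ts ⊆ᵇ Ω)) (∨-true (nonempty S))))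
           (size-∷ S Ts)) ⟩
    _ ≡⟨ ∑-cong (allSubsets n) (λ S → ∑-support-⊆ Ω (λ j → f (∣ S ∣ˢ ℕ.+ j))) ⟩
    _ ≡⟨ ∑ˢ-+ n (∣ Ω ∣ˢ ℕ.* n) f ⟨
    ∑ˢ (n ℕ.+ ∣ Ω ∣ˢ ℕ.* n) f ∎
    where
    ∨-true : ∀ a → not a ∨ true ≡ true
    ∨-true true  = refl
    ∨-true false = refl
  ∑-support-⊆ {suc m} (false ∷ Ω) f = begin
    _ ≡⟨ ∑-blocks-suc m n _ ⟩
    _ ≡⟨ ∑-cong (allSubsets n) (λ S → ∑-cong (blocks m n) λ Ts → cong (λ b → ι b * f (size (S ∷ Ts)))
           (trans (⊆ᵇ-∷ (nonempty S) false (support Ts) Ω) (cong (_∧ (support Ts ⊆ᵇ Ω)) (∨-false (nonempty S))))) ⟩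
    _ ≡⟨ ∑-first-empty m (λ Ts → support Ts ⊆ᵇ Ω) f ⟩
    _ ≡⟨ ∑-support-⊆ Ω f ⟩
    ∑ˢ (∣ Ω ∣ˢ ℕ.* n) f ∎
    where
    ∨-false : ∀ a → not a ∨ false ≡ not a
    ∨-false true  = refl
    ∨-false false = refl

  module _ (c : VSet n → Bool) where

    -- Induction on the first vertex. If it is the centre, everything else is empty and a sum over
    -- one block remains (`head-centre`); otherwise its block is empty and the centre lies further
    -- on (`tail-centre`). Each vertex contributes one `K`.
    ∑-centred : ∀ m (f : ℕ → ℤ) →
      ∑ (allSubsets m) (λ Q → ∑ (blocks m n) (λ Ts → ι (centred c Q Ts) * f (size Ts))) ≡
      + m * ∑ (allSubsets n) (λ S → ι (c S ∧ nonempty S) * f ∣ S ∣ˢ)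
    ∑-centred zero    f = refl
    ∑-centred (suc m) f = begin
      _ ≡⟨ ∑-cong (allSubsets (suc m)) (λ Q → ∑-blocks-suc m n _) ⟩
      _ ≡⟨ ∑-subsets-suc m _ ⟩
      _ ≡⟨ cong₂ _+_ head-centre tail-centre ⟩
      K + + m * K ≡⟨ suc-* (+ m) K ⟨
      + suc m * K ∎
      where
      K = ∑ (allSubsets n) (λ S → ι (c S ∧ nonempty S) * f ∣ S ∣ˢ)
      q : VSet m → Vec (VSet n) m → Bool
      q Q Ts = not (nonempty Q) ∧ not (nonempty (support Ts))
      head-centre :
        ∑ (allSubsets m) (λ Q → ∑ (allSubsets n) (λ S → ∑ (blocks m n) (λ Ts →
          ι ((c S ∧ nonempty S) ∧ q Q Ts) * f (size (S ∷ Ts))))) ≡ K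
      head-centre = begin
        _ ≡⟨ ∑-cong (allSubsets m) (λ Q → ∑-blocks-∧ m (λ S → c S ∧ nonempty S) (q Q) f) ⟩
        _ ≡⟨ ∑-cong (allSubsets m) (λ Q → trans
               (∑-cong (allSubsets n) (λ S → inner Q (ι (c S ∧ nonempty S)) (λ j → f (∣ S ∣ˢ ℕ.+ j))))
               (∑-*ˡ (ι (not (nonempty Q))) _ (allSubsets n))) ⟩
        _ ≡⟨ ∑-empty m (λ _ → ∑ (allSubsets n) (λ S → ι (c S ∧ nonempty S) * f (∣ S ∣ˢ ℕ.+ 0))) ⟩
        _ ≡⟨ ∑-cong (allSubsets n) (λ S → cong (λ k → ι (c S ∧ nonempty S) * f k) (ℕP.+-identityʳ _)) ⟩
        K ∎
        where
        inner : ∀ Q z (g : ℕ → ℤ) →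
          z * ∑ (blocks m n) (λ Ts → ι (q Q Ts) * g (size Ts)) ≡ ι (not (nonempty Q)) * (z * g 0)
        inner Q z g = begin
          z * ∑ (blocks m n) (λ Ts → ι (q Q Ts) * g (size Ts))
            ≡⟨ cong (z *_) (∑-cong (blocks m n) λ Ts →
                 trans (cong (_* g (size Ts)) (ι-∧ (not (nonempty Q)) _)) (*-assoc e _ _)) ⟩
          z * ∑ (blocks m n) (λ Ts → e * (ι (not (nonempty (support Ts))) * g (size Ts)))
            ≡⟨ cong (z *_) (trans (∑-*ˡ e _ (blocks m n)) (cong (e *_) (∑-blocks-empty m g))) ⟩
          z * (e * g 0) ≡⟨ *-assoc z e _ ⟨
          z * e * g 0   ≡⟨ cong (_* g 0) (*-comm z e) ⟩
          e * z * g 0   ≡⟨ *-assoc e z _ ⟩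
          e * (z * g 0) ∎
          where e = ι (not (nonempty Q))
      tail-centre :
        ∑ (allSubsets m) (λ Q → ∑ (allSubsets n) (λ S → ∑ (blocks m n) (λ Ts →
          ι (not (nonempty S) ∧ centred c Q Ts) * f (size (S ∷ Ts))))) ≡ + m * K
      tail-centre = trans (∑-cong (allSubsets m) (λ Q → ∑-first-empty m (centred c Q) f)) (∑-centred m f)

-- The source of the factor x in m x (V_2(H) - 1).
centred-size : ∀ {m n} (c : VSet n → Bool) (Q : VSet m) Ts → centred c Q Ts ≡ true → ∣ Q ∣ˢ ≡ 1
centred-size c []          []       ()
centred-size c (true  ∷ Q) (S ∷ Ts) p =
  cong suc (empty⇒∣∣≡0 Q (not⁻ (proj₁ (∧⁻ (proj₂ (∧⁻ {c S ∧ nonempty S} p))))))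
centred-size c (false ∷ Q) (S ∷ Ts) p = centred-size c Q Ts (proj₂ (∧⁻ {not (nonempty S)} p))

-- Coefficients of products

*ₚ-zero : ∀ p q → (p *ₚ q) 0 ≡ p 0 * q 0
*ₚ-zero p q = +-identityʳ _

-- This is the splitting p = p(0) + x p′ with p′ = `p ∘ suc`; the product computations below are
-- inductions along it.
*ₚ-suc : ∀ p q i → (p *ₚ q) (suc i) ≡ p 0 * q (suc i) + ((p ∘ suc) *ₚ q) i
*ₚ-suc p q i = cong (λ l → p 0 * q (suc i) + foldr _+_ (+ 0) l)
  (trans (map-applyUpTo suc (λ j → p j * q (suc i ℕ.∸ j)) (suc i))
         (sym (map-applyUpTo id (λ j → p (suc j) * q (i ℕ.∸ j)) (suc i))))

*ₚ-zeroˡ : ∀ p q → (∀ j → p j ≡ + 0) → ∀ i → (p *ₚ q) i ≡ + 0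
*ₚ-zeroˡ p q p≈0 zero    = trans (*ₚ-zero p q) (cong (_* q 0) (p≈0 0))
*ₚ-zeroˡ p q p≈0 (suc i) = trans (*ₚ-suc p q i)
  (cong₂ _+_ (cong (_* q (suc i)) (p≈0 0)) (*ₚ-zeroˡ (p ∘ suc) q (p≈0 ∘ suc) i))

*ₚ-identityˡ : ∀ p q → p ≈ₚ 1ₚ → (p *ₚ q) ≈ₚ q
*ₚ-identityˡ p q p≈1 zero    = trans (*ₚ-zero p q) (trans (cong (_* q 0) (p≈1 0)) (*-identityˡ _))
*ₚ-identityˡ p q p≈1 (suc i) = begin
  (p *ₚ q) (suc i)                           ≡⟨ *ₚ-suc p q i ⟩
  p 0 * q (suc i) + ((p ∘ suc) *ₚ q) i       ≡⟨ cong₂ _+_ (cong (_* q (suc i)) (p≈1 0)) (*ₚ-zeroˡ (p ∘ suc) q (p≈1 ∘ suc) i) ⟩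
  + 1 * q (suc i) + + 0                      ≡⟨ trans (+-identityʳ _) (*-identityˡ _) ⟩
  q (suc i)                                  ∎

*ₚ-identityʳ : ∀ p → (p *ₚ 1ₚ) ≈ₚ p
*ₚ-identityʳ p zero    = trans (*ₚ-zero p 1ₚ) (*-identityʳ _)
*ₚ-identityʳ p (suc i) = begin
  (p *ₚ 1ₚ) (suc i)                  ≡⟨ *ₚ-suc p 1ₚ i ⟩
  p 0 * + 0 + ((p ∘ suc) *ₚ 1ₚ) i    ≡⟨ cong₂ _+_ (*-zeroʳ (p 0)) (*ₚ-identityʳ (p ∘ suc) i) ⟩
  + 0 + p (suc i)                    ≡⟨ +-identityˡ _ ⟩
  p (suc i)                          ∎

xₚ∘suc : (xₚ ∘ suc) ≈ₚ 1ₚ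
xₚ∘suc zero    = refl
xₚ∘suc (suc i) = refl

x*-suc : ∀ p i → (xₚ *ₚ p) (suc i) ≡ p i
x*-suc p i = trans (*ₚ-suc xₚ p i) (trans (+-identityˡ _) (*ₚ-identityˡ (xₚ ∘ suc) p xₚ∘suc i))

1+x*-suc : ∀ p i → ((1ₚ +ₚ xₚ) *ₚ p) (suc i) ≡ p i + p (suc i)
1+x*-suc p i = begin
  ((1ₚ +ₚ xₚ) *ₚ p) (suc i)                            ≡⟨ *ₚ-suc (1ₚ +ₚ xₚ) p i ⟩
  + 1 * p (suc i) + (((1ₚ +ₚ xₚ) ∘ suc) *ₚ p) i
    ≡⟨ cong₂ _+_ (*-identityˡ (p (suc i))) (*ₚ-identityˡ ((1ₚ +ₚ xₚ) ∘ suc) p (λ j → trans (+-identityˡ _) (xₚ∘suc j)) i) ⟩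
  p (suc i) + p i                                      ≡⟨ +-comm (p (suc i)) _ ⟩
  p i + p (suc i)                                      ∎

*x-zero : ∀ p q → (p *ₚ (xₚ *ₚ q)) 0 ≡ + 0
*x-zero p q = trans (*ₚ-zero p (xₚ *ₚ q)) (*-zeroʳ (p 0))

*x-suc : ∀ p q i → (p *ₚ (xₚ *ₚ q)) (suc i) ≡ (p *ₚ q) i
*x-suc p q zero = begin
  (p *ₚ (xₚ *ₚ q)) 1                                       ≡⟨ *ₚ-suc p (xₚ *ₚ q) 0 ⟩
  p 0 * (xₚ *ₚ q) 1 + ((p ∘ suc) *ₚ (xₚ *ₚ q)) 0           ≡⟨ cong₂ _+_ (cong (p 0 *_) (x*-suc q 0)) (*x-zero (p ∘ suc) q) ⟩
  p 0 * q 0 + + 0                                          ≡⟨⟩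
  (p *ₚ q) 0                                               ∎
*x-suc p q (suc i) = begin
  (p *ₚ (xₚ *ₚ q)) (suc (suc i))                                             ≡⟨ *ₚ-suc p (xₚ *ₚ q) (suc i) ⟩
  p 0 * (xₚ *ₚ q) (suc (suc i)) + ((p ∘ suc) *ₚ (xₚ *ₚ q)) (suc i)           ≡⟨ cong₂ _+_ (cong (p 0 *_) (x*-suc q (suc i))) (*x-suc (p ∘ suc) q i) ⟩
  p 0 * q (suc i) + ((p ∘ suc) *ₚ q) i                                       ≡⟨ *ₚ-suc p q i ⟨
  (p *ₚ q) (suc i)                                                           ∎

δ : ℕ → ℕ → ℤ
δ i k = ι (k ≡ᵇ i)

1ₚ-δ : ∀ i → 1ₚ i ≡ δ i 0
1ₚ-δ zero    = refl
1ₚ-δ (suc i) = refl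

-- Pascal's rule: multiplying by 1 + x and splitting the subsets by their first element give the
-- same recursion.
binomial-∑ˢ : ∀ k i → ((1ₚ +ₚ xₚ) ^ₚ k) i ≡ ∑ˢ k (δ i)
binomial-∑ˢ zero    i       = trans (1ₚ-δ i) (sym (+-identityʳ _))
binomial-∑ˢ (suc k) zero    = begin
  ((1ₚ +ₚ xₚ) *ₚ (1ₚ +ₚ xₚ) ^ₚ k) 0                          ≡⟨ *ₚ-zero (1ₚ +ₚ xₚ) ((1ₚ +ₚ xₚ) ^ₚ k) ⟩
  + 1 * ((1ₚ +ₚ xₚ) ^ₚ k) 0                                  ≡⟨ *-identityˡ _ ⟩
  ((1ₚ +ₚ xₚ) ^ₚ k) 0                                        ≡⟨ binomial-∑ˢ k 0 ⟩
  ∑ˢ k (δ 0)                                                 ≡⟨ +-identityˡ _ ⟨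
  + 0 + ∑ˢ k (δ 0)                                           ≡⟨ cong (_+ ∑ˢ k (δ 0)) (∑-zero (allSubsets k)) ⟨
  ∑ (allSubsets k) (λ _ → + 0) + ∑ˢ k (δ 0)                  ≡⟨ ∑-subsets-suc k _ ⟨
  ∑ˢ (suc k) (δ 0)                                           ∎
binomial-∑ˢ (suc k) (suc i) = begin
  ((1ₚ +ₚ xₚ) *ₚ (1ₚ +ₚ xₚ) ^ₚ k) (suc i)                    ≡⟨ 1+x*-suc ((1ₚ +ₚ xₚ) ^ₚ k) i ⟩
  ((1ₚ +ₚ xₚ) ^ₚ k) i + ((1ₚ +ₚ xₚ) ^ₚ k) (suc i)            ≡⟨ cong₂ _+_ (binomial-∑ˢ k i) (binomial-∑ˢ k (suc i)) ⟩
  ∑ˢ k (δ i) + ∑ˢ k (δ (suc i))                              ≡⟨ ∑-subsets-suc k _ ⟨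
  ∑ˢ (suc k) (δ (suc i))                                     ∎

-- Both terms on the right come from one test function, `λ t → δ i (q ℕ.+ t)`; the unsimplified
-- `q ℕ.+ 0` is its value at 0, the shape `∑-cover` expects.
shifted-binomial-∑ˢ : ∀ k q i →
  (((1ₚ +ₚ xₚ) ^ₚ k -ₚ 1ₚ) *ₚ xₚ ^ₚ q) i ≡ ∑ˢ k (λ t → δ i (q ℕ.+ t)) - δ i (q ℕ.+ 0)
shifted-binomial-∑ˢ k zero i =
  trans (*ₚ-identityʳ ((1ₚ +ₚ xₚ) ^ₚ k -ₚ 1ₚ) i) (cong₂ _-_ (binomial-∑ˢ k i) (1ₚ-δ i))
shifted-binomial-∑ˢ k (suc q) zero =
  trans (*x-zero ((1ₚ +ₚ xₚ) ^ₚ k -ₚ 1ₚ) (xₚ ^ₚ q)) (sym (trans (+-identityʳ _) (∑-zero (allSubsets k))))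
shifted-binomial-∑ˢ k (suc q) (suc i) =
  trans (*x-suc ((1ₚ +ₚ xₚ) ^ₚ k -ₚ 1ₚ) (xₚ ^ₚ q) i) (shifted-binomial-∑ˢ k q i)

sumₚ-∑ : ∀ {A : Set} (F : A → Poly) xs i → sumₚ (map F xs) i ≡ ∑ xs (λ a → F a i)
sumₚ-∑ F []       zero    = refl
sumₚ-∑ F []       (suc i) = refl
sumₚ-∑ F (x ∷ xs) i       = cong (_+_ (F x i)) (sumₚ-∑ F xs i)

-- Maximal absolute visible sets

∈-allSubsets : ∀ {n} (X : VSet n) → X ∈ allSubsets n
∈-allSubsets []          = here refl
∈-allSubsets (true  ∷ X) = ∈-++⁺ˡ (∈-map⁺ (true ∷_) (∈-allSubsets X))
∈-allSubsets {suc n} (false ∷ X) = ∈-++⁺ʳ (map (true ∷_) (allSubsets n)) (∈-map⁺ (false ∷_) (∈-allSubsets X))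

⊆ᵇ-refl : ∀ {n} (X : VSet n) → X ⊆ᵇ X ≡ true
⊆ᵇ-refl X = ⊆ᵇ⁺ X X λ _ p → p

⊆ᵇ-trans : ∀ {n} (X Y Z : VSet n) → X ⊆ᵇ Y ≡ true → Y ⊆ᵇ Z ≡ true → X ⊆ᵇ Z ≡ true
⊆ᵇ-trans X Y Z p q = ⊆ᵇ⁺ X Z λ v → ⊆ᵇ⁻ Y Z q v ∘ ⊆ᵇ⁻ X Y p v

⊆ᵇ-tail : ∀ {n} a b (X Y : VSet n) → (a ∷ X) ⊆ᵇ (b ∷ Y) ≡ true → X ⊆ᵇ Y ≡ true
⊆ᵇ-tail a b X Y p = ⊆ᵇ⁺ X Y λ v → ⊆ᵇ⁻ (a ∷ X) (b ∷ Y) p (suc v)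

⊆ᵇ-∣∣ : ∀ {n} (X Y : VSet n) → X ⊆ᵇ Y ≡ true → ∣ X ∣ˢ ≤ ∣ Y ∣ˢ
⊆ᵇ-∣∣ []          []          p = z≤n
⊆ᵇ-∣∣ (true  ∷ X) (true  ∷ Y) p = s≤s (⊆ᵇ-∣∣ X Y (⊆ᵇ-tail true true X Y p))
⊆ᵇ-∣∣ (true  ∷ X) (false ∷ Y) p = true≢false (⊆ᵇ⁻ (true ∷ X) (false ∷ Y) p zero refl) refl
⊆ᵇ-∣∣ (false ∷ X) (true  ∷ Y) p = m≤n⇒m≤1+n (⊆ᵇ-∣∣ X Y (⊆ᵇ-tail false true X Y p))
⊆ᵇ-∣∣ (false ∷ X) (false ∷ Y) p = ⊆ᵇ-∣∣ X Y (⊆ᵇ-tail false false X Y p)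

⊆ᵇ-∣∣⇒≡ : ∀ {n} (X Y : VSet n) → X ⊆ᵇ Y ≡ true → ∣ Y ∣ˢ ≤ ∣ X ∣ˢ → X ≡ Y
⊆ᵇ-∣∣⇒≡ []          []          p le = refl
⊆ᵇ-∣∣⇒≡ (true  ∷ X) (true  ∷ Y) p (s≤s le) = cong (true ∷_) (⊆ᵇ-∣∣⇒≡ X Y (⊆ᵇ-tail true true X Y p) le)
⊆ᵇ-∣∣⇒≡ (true  ∷ X) (false ∷ Y) p le = true≢false (⊆ᵇ⁻ (true ∷ X) (false ∷ Y) p zero refl) refl
⊆ᵇ-∣∣⇒≡ (false ∷ X) (true  ∷ Y) p le = ⊥-elim (<-irrefl refl (≤-trans le (⊆ᵇ-∣∣ X Y (⊆ᵇ-tail false true X Y p))))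
⊆ᵇ-∣∣⇒≡ (false ∷ X) (false ∷ Y) p le = cong (false ∷_) (⊆ᵇ-∣∣⇒≡ X Y (⊆ᵇ-tail false false X Y p) le)

==ˢ⇒≡ : ∀ {n} (X Y : VSet n) → X ==ˢ Y ≡ true → X ≡ Y
==ˢ⇒≡ X Y p with ∧⁻ {X ⊆ᵇ Y} p
... | q , r = ⊆ᵇ-∣∣⇒≡ X Y q (⊆ᵇ-∣∣ Y X r)

==ˢ-refl : ∀ {n} (X : VSet n) → X ==ˢ X ≡ true
==ˢ-refl X = ∧⁺ (⊆ᵇ-refl X) (⊆ᵇ-refl X)

∧-falseʳ : ∀ {a b} → a ≡ true → a ∧ b ≡ false → b ≡ false
∧-falseʳ refl p = p

all-false : ∀ {A : Set} (p : A → Bool) xs → all p xs ≡ false → ∃ λ x → p x ≡ false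
all-false p (x ∷ xs) q with p x in eq
... | false = x , eq
... | true  = all-false p xs q

module _ (G : Graph) (Q : VSet (order G)) where

  -- In every clause the blocking set is `Q`, never `W`, so shrinking `W` only removes conditions.
  isAbsCQ-⊆ : ∀ W W′ → W ⊆ᵇ W′ ≡ true → isAbsCQ G Q W′ ≡ true → isAbsCQ G Q W ≡ true
  isAbsCQ-⊆ W W′ W⊆W′ abs = isAbsCQ⁺ G Q W record
    { disjoint = λ w w∈W → disjoint w (sub w w∈W)
    ; within   = λ u w u∈W w∈W → within u w (sub u u∈W) (sub w w∈W)
    ; across   = λ u w u∈Q w∈W → across u w u∈Q (sub w w∈W)
    ; internal = internal
    }
    where
    open AbsVisible (isAbsCQ⁻ G Q W′ abs)
    sub = ⊆ᵇ⁻ W W′ W⊆W′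

  -- A set that is not maximal has an absolute c_Q-visible superset of larger cardinality; `b`
  -- bounds how often the cardinality can still grow below `order G`.
  maximal-above : ∀ b W → order G ≤ ∣ W ∣ˢ ℕ.+ b → isAbsCQ G Q W ≡ true →
                  ∃ λ Ω → isMaxAbsCQ G Q Ω ≡ true × W ⊆ᵇ Ω ≡ true
  maximal-above b W m≤ abs with isMaxAbsCQ G Q W in eq
  ... | true  = W , eq , ⊆ᵇ-refl W
  ... | false with all-false (λ W′ → not (W ⊆ᵇ W′) ∨ (W′ ==ˢ W) ∨ not (isAbsCQ G Q W′)) (allSubsets (order G)) (∧-falseʳ abs eq)
  ...   | W′ , fails = larger b m≤
    where
    refuted : ∀ a b c → not a ∨ b ∨ not c ≡ false → a ≡ true × b ≡ false × c ≡ true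
    refuted true false true _ = refl , refl , refl
    split = refuted (W ⊆ᵇ W′) (W′ ==ˢ W) (isAbsCQ G Q W′) fails
    W⊆W′ = proj₁ split
    W′≠W = proj₁ (proj₂ split)
    abs′ = proj₂ (proj₂ split)
    W<W′ : ∣ W ∣ˢ < ∣ W′ ∣ˢ
    W<W′ = ≰⇒> λ le →
      true≢false (subst (λ Y → Y ==ˢ W ≡ true) (⊆ᵇ-∣∣⇒≡ W W′ W⊆W′ le) (==ˢ-refl W)) W′≠W
    larger : ∀ b → order G ≤ ∣ W ∣ˢ ℕ.+ b → ∃ λ Ω → isMaxAbsCQ G Q Ω ≡ true × W ⊆ᵇ Ω ≡ true
    larger zero    m≤ = ⊥-elim (<-irrefl refl (<-≤-trans W<W′ (≤-trans (count≤n (_≟ true) W′)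
                          (≤-trans m≤ (≤-reflexive (ℕP.+-identityʳ _))))))
    larger (suc b) m≤ with maximal-above b W′ (≤-trans m≤ (≤-trans (≤-reflexive (ℕP.+-suc _ b)) (+-monoˡ-≤ b W<W′))) abs′
    ... | Ω , max , W′⊆Ω = Ω , max , ⊆ᵇ-trans W W′ Ω W⊆W′ W′⊆Ω

  ∈Γ⁺ : ∀ Ω → isMaxAbsCQ G Q Ω ≡ true → Ω ∈ Γ G Q
  ∈Γ⁺ Ω max = ∈-filter⁺ (λ W → isMaxAbsCQ G Q W ≟ true) (∈-allSubsets Ω) max

  ∈Γ⁻ : ∀ Ω → Ω ∈ Γ G Q → isMaxAbsCQ G Q Ω ≡ true
  ∈Γ⁻ Ω i = proj₂ (∈-filter⁻ (λ W → isMaxAbsCQ G Q W ≟ true) {xs = allSubsets (order G)} i)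

  isAbsCQ-any : ∀ W → isAbsCQ G Q W ≡ any (W ⊆ᵇ_) (Γ G Q)
  isAbsCQ-any W = bool-ext below above
    where
    below : isAbsCQ G Q W ≡ true → any (W ⊆ᵇ_) (Γ G Q) ≡ true
    below abs with maximal-above (order G) W (m≤n+m _ _) abs
    ... | Ω , max , W⊆Ω = any⁺ (W ⊆ᵇ_) (∈Γ⁺ Ω max) W⊆Ω
    above : any (W ⊆ᵇ_) (Γ G Q) ≡ true → isAbsCQ G Q W ≡ true
    above p with any⁻ (W ⊆ᵇ_) (Γ G Q) p
    ... | Ω , Ω∈Γ , W⊆Ω = isAbsCQ-⊆ W Ω W⊆Ω (proj₁ (∧⁻ {isAbsCQ G Q Ω} (∈Γ⁻ Ω Ω∈Γ)))

-- Inclusion–exclusion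

module _ {A : Set} where

  ∑-sublists-∷ : ∀ (f : List A → ℤ) x xs →
    ∑ (sublists (x ∷ xs)) f ≡ ∑ (sublists xs) (f ∘ (x ∷_)) + ∑ (sublists xs) f
  ∑-sublists-∷ f x xs = trans (∑-++ f (map (x ∷_) (sublists xs)) (sublists xs))
                              (cong (_+ ∑ (sublists xs) f) (∑-map (x ∷_) f (sublists xs)))

  private
    nonNil : (List A → ℤ) → List A → ℤ
    nonNil f []       = + 0
    nonNil f (x ∷ xs) = f (x ∷ xs)

    ∑-filter-nonNil : ∀ f (xss : List (List A)) → ∑ (filter (λ J → 1 ℕ.≤? length J) xss) f ≡ ∑ xss (nonNil f)
    ∑-filter-nonNil f []             = refl
    ∑-filter-nonNil f ([] ∷ xss)     = trans (∑-filter-nonNil f xss) (sym (+-identityˡ _))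
    ∑-filter-nonNil f ((x ∷ J) ∷ xss) = cong (_+_ (f (x ∷ J))) (∑-filter-nonNil f xss)

  ∑-nonempty-sublists : ∀ f (xs : List A) →
    ∑ (filter (λ J → 1 ℕ.≤? length J) (sublists xs)) f + f [] ≡ ∑ (sublists xs) f
  ∑-nonempty-sublists f xs = trans (cong (_+ f []) (∑-filter-nonNil f (sublists xs))) (go xs)
    where
    go : ∀ xs → ∑ (sublists xs) (nonNil f) + f [] ≡ ∑ (sublists xs) f
    go []       = trans (+-identityˡ (f [])) (sym (+-identityʳ (f [])))
    go (x ∷ xs) = begin
      ∑ (sublists (x ∷ xs)) (nonNil f) + f []
        ≡⟨ cong (_+ f []) (∑-sublists-∷ (nonNil f) x xs) ⟩
      ∑ (sublists xs) (f ∘ (x ∷_)) + ∑ (sublists xs) (nonNil f) + f []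
        ≡⟨ +-assoc (∑ (sublists xs) (f ∘ (x ∷_))) _ _ ⟩
      ∑ (sublists xs) (f ∘ (x ∷_)) + (∑ (sublists xs) (nonNil f) + f [])
        ≡⟨ cong (_+_ (∑ (sublists xs) (f ∘ (x ∷_)))) (go xs) ⟩
      ∑ (sublists xs) (f ∘ (x ∷_)) + ∑ (sublists xs) f
        ≡⟨ ∑-sublists-∷ f x xs ⟨
      ∑ (sublists (x ∷ xs)) f ∎

module _ {n} (W : VSet n) where

  ⊆ᵇ-full : W ⊆ᵇ V.replicate n true ≡ true
  ⊆ᵇ-full = ⊆ᵇ⁺ W (V.replicate n true) λ v _ → lookup-replicate v true

  ⊆ᵇ-∩ : ∀ X Y → W ⊆ᵇ (X ∩ˢ Y) ≡ (W ⊆ᵇ X) ∧ (W ⊆ᵇ Y)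
  ⊆ᵇ-∩ X Y = bool-ext
    (λ p → ∧⁺ (⊆ᵇ⁺ W X λ v v∈W → proj₁ (both p v v∈W)) (⊆ᵇ⁺ W Y λ v v∈W → proj₂ (both p v v∈W)))
    (λ p → let p₁ , p₂ = ∧⁻ {W ⊆ᵇ X} p in
      ⊆ᵇ⁺ W (X ∩ˢ Y) λ v v∈W → trans (lookup-zipWith _∧_ v X Y) (∧⁺ (⊆ᵇ⁻ W X p₁ v v∈W) (⊆ᵇ⁻ W Y p₂ v v∈W)))
    where
    both : W ⊆ᵇ (X ∩ˢ Y) ≡ true → ∀ v → v ∈ᵇ W ≡ true → v ∈ᵇ X ≡ true × v ∈ᵇ Y ≡ true
    both p v v∈W = ∧⁻ {v ∈ᵇ X} (trans (sym (lookup-zipWith _∧_ v X Y)) (⊆ᵇ⁻ W (X ∩ˢ Y) p v v∈W))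

  -- Both sides equal - ∏ (1 - [W ⊆ Ω]), the product being over Ω in L.
  ∑-sublists-sign : ∀ L → ∑ (sublists L) (λ J → sign (length J) * ι (W ⊆ᵇ ⋂ J)) ≡ - ι (not (any (W ⊆ᵇ_) L))
  ∑-sublists-sign []      = cong (λ b → sign 0 * ι b + + 0) ⊆ᵇ-full
  ∑-sublists-sign (Ω ∷ L) = begin
    ∑ (sublists (Ω ∷ L)) (λ J → sign (length J) * ι (W ⊆ᵇ ⋂ J))
      ≡⟨ ∑-sublists-∷ _ Ω L ⟩
    ∑ (sublists L) (λ J → - sign (length J) * ι (W ⊆ᵇ (Ω ∩ˢ ⋂ J))) + S
      ≡⟨ cong (_+ S) (∑-cong (sublists L) λ J → term (sign (length J)) J) ⟩
    ∑ (sublists L) (λ J → - ι (W ⊆ᵇ Ω) * (sign (length J) * ι (W ⊆ᵇ ⋂ J))) + S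
      ≡⟨ cong (_+ S) (∑-*ˡ (- ι (W ⊆ᵇ Ω)) _ (sublists L)) ⟩
    - ι (W ⊆ᵇ Ω) * S + S
      ≡⟨ cong (λ s → - ι (W ⊆ᵇ Ω) * s + s) (∑-sublists-sign L) ⟩
    - ι (W ⊆ᵇ Ω) * - ι (not (any (W ⊆ᵇ_) L)) + - ι (not (any (W ⊆ᵇ_) L))
      ≡⟨ absorb (W ⊆ᵇ Ω) (any (W ⊆ᵇ_) L) ⟩
    - ι (not ((W ⊆ᵇ Ω) ∨ any (W ⊆ᵇ_) L)) ∎
    where
    S = ∑ (sublists L) (λ J → sign (length J) * ι (W ⊆ᵇ ⋂ J))
    term : ∀ s J → - s * ι (W ⊆ᵇ (Ω ∩ˢ ⋂ J)) ≡ - ι (W ⊆ᵇ Ω) * (s * ι (W ⊆ᵇ ⋂ J))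
    term s J = begin
      - s * ι (W ⊆ᵇ (Ω ∩ˢ ⋂ J))  ≡⟨ cong (λ b → - s * ι b) (⊆ᵇ-∩ Ω (⋂ J)) ⟩
      - s * ι ((W ⊆ᵇ Ω) ∧ (W ⊆ᵇ ⋂ J)) ≡⟨ cong (- s *_) (ι-∧ (W ⊆ᵇ Ω) _) ⟩
      - s * (a * b)                ≡⟨ *-assoc (- s) a b ⟨
      - s * a * b                  ≡⟨ cong (_* b) (trans (sym (neg-distribˡ-* s a)) (trans (cong -_ (*-comm s a)) (neg-distribˡ-* a s))) ⟩
      - a * s * b                  ≡⟨ *-assoc (- a) s b ⟩
      - a * (s * b)                ∎
      where
      a = ι (W ⊆ᵇ Ω)
      b = ι (W ⊆ᵇ ⋂ J)
    absorb : ∀ a b → - ι a * - ι (not b) + - ι (not b) ≡ - ι (not (a ∨ b))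
    absorb true  true  = refl
    absorb true  false = refl
    absorb false true  = refl
    absorb false false = refl

  inclusion-exclusion : ∀ L →
    ∑ (filter (λ J → 1 ℕ.≤? length J) (sublists L)) (λ J → sign (length J) * ι (W ⊆ᵇ ⋂ J)) ≡
    ι (any (W ⊆ᵇ_) L)
  inclusion-exclusion L = begin
    S                      ≡⟨ +-identityʳ S ⟨
    S + + 0                ≡⟨ +-assoc S (- + 1) (+ 1) ⟨
    -- The empty subfamily has intersection `⋂ []`, the full vertex set, and sign -1, so its term is
    -- -1. Inserting it completes the sum to all sublists.
    S + - + 1 + + 1        ≡⟨ cong (λ b → S + sign 0 * ι b + + 1) ⊆ᵇ-full ⟨
    S + f [] + + 1         ≡⟨ cong (_+ + 1) (trans (∑-nonempty-sublists f L) (∑-sublists-sign L)) ⟩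
    - ι (not (any (W ⊆ᵇ_) L)) + + 1 ≡⟨ complement (any (W ⊆ᵇ_) L) ⟩
    ι (any (W ⊆ᵇ_) L)      ∎
    where
    f : List (VSet n) → ℤ
    f J = sign (length J) * ι (W ⊆ᵇ ⋂ J)
    S = ∑ (filter (λ J → 1 ℕ.≤? length J) (sublists L)) f
    complement : ∀ a → - ι (not a) + + 1 ≡ ι a
    complement true  = refl
    complement false = refl

-- The disjoint case

∑-unique : ∀ n (P : VSet n → Bool) → (∀ X Y → P X ≡ true → P Y ≡ true → X ≡ Y) →
           ∑ (allSubsets n) (ι ∘ P) ≡ ι (any P (allSubsets n))
∑-unique n P unique with any P (allSubsets n) in eq
... | false = trans (∑-cong (allSubsets n) λ X → cong ι (≢true⇒false λ p → true≢false (any⁺ P (∈-allSubsets X) p) eq))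
                    (∑-zero (allSubsets n))
... | true with any⁻ P (allSubsets n) eq
...   | X , _ , PX = single n P X PX unique
  where
  single : ∀ n (P : VSet n → Bool) X → P X ≡ true → (∀ X Y → P X ≡ true → P Y ≡ true → X ≡ Y) →
           ∑ (allSubsets n) (ι ∘ P) ≡ + 1
  single zero P [] PX unique = cong (λ b → ι b + + 0) PX
  single (suc n) P (true ∷ X) PX unique = trans (∑-subsets-suc n (ι ∘ P)) (cong₂ _+_
    (single n (P ∘ (true ∷_)) X PX (λ Y Z p q → cong V.tail (unique (true ∷ Y) (true ∷ Z) p q)))
    (trans (∑-cong (allSubsets n) λ Y → cong ι (≢true⇒false λ p → true≢false (cong V.head (unique (false ∷ Y) (true ∷ X) p PX)) refl))
           (∑-zero (allSubsets n))))
  single (suc n) P (false ∷ X) PX unique = trans (∑-subsets-suc n (ι ∘ P)) (cong₂ _+_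
    (trans (∑-cong (allSubsets n) λ Y → cong ι (≢true⇒false λ p → true≢false (cong V.head (unique (false ∷ X) (true ∷ Y) PX p)) refl))
           (∑-zero (allSubsets n)))
    (single n (P ∘ (false ∷_)) X PX (λ Y Z p q → cong V.tail (unique (false ∷ Y) (false ∷ Z) p q))))

module _ (G : Graph) (Q : VSet (order G)) where

  disjointVisible⁻ : isDisjointVisible G Q ≡ true → ∀ {X Y} → X ∈ Γ G Q → Y ∈ Γ G Q →
                     X ≡ Y ⊎ (∀ v → v ∈ᵇ X ≡ true → v ∈ᵇ Y ≡ false)
  disjointVisible⁻ dv {X} {Y} X∈Γ Y∈Γ with ∨⁻ {length (Γ G Q) ≤ᵇ 1} dv
  ... | inj₁ short = inj₁ (same (Γ G Q) (≤ᵇ⇒≤ _ 1 (Equivalence.from T-≡ short)) X∈Γ Y∈Γ)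
    where
    same : ∀ L → length L ≤ 1 → X ∈ L → Y ∈ L → X ≡ Y
    same (_ ∷ [])    _        (here refl) (here refl) = refl
    same (_ ∷ _ ∷ _) (s≤s ()) _           _
  ... | inj₂ pairwise with ∨⁻ {X ==ˢ Y} (all⁻ _ (Γ G Q) (all⁻ _ (Γ G Q) pairwise X∈Γ) Y∈Γ)
  ...   | inj₁ eq = inj₁ (==ˢ⇒≡ X Y eq)
  ...   | inj₂ dis = inj₂ λ v v∈X → ≢true⇒false λ v∈Y →
          true≢false (⊆ᵇ⁻ (X ∩ˢ Y) ∅ˢ (proj₁ (∧⁻ {(X ∩ˢ Y) ⊆ᵇ ∅ˢ} dis)) v (trans (lookup-zipWith _∧_ v X Y) (∧⁺ v∈X v∈Y)))
                     (∅ˢ-∉ v)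

  -- A vertex of `W` lies in at most one of the disjoint maximal sets, so at most one of them
  -- contains `W`. An empty `W` would instead be counted once per maximal set.
  ∑-disjoint : isDisjointVisible G Q ≡ true → ∀ W → nonempty W ≡ true →
               ∑ (Γ G Q) (λ Ω → ι (W ⊆ᵇ Ω)) ≡ ι (any (W ⊆ᵇ_) (Γ G Q))
  ∑-disjoint dv W ne = begin
    ∑ (Γ G Q) (λ Ω → ι (W ⊆ᵇ Ω))
      -- Passing to the enumeration of all subsets, which lists each set exactly once, excludes a
      -- maximal set being counted twice through a repeated entry.
      ≡⟨ ∑-filter (isMaxAbsCQ G Q) (λ Ω → ι (W ⊆ᵇ Ω)) (allSubsets (order G)) ⟩
    ∑ (allSubsets (order G)) (λ Ω → ι (isMaxAbsCQ G Q Ω) * ι (W ⊆ᵇ Ω))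
      ≡⟨ ∑-cong (allSubsets (order G)) (λ Ω → sym (ι-∧ (isMaxAbsCQ G Q Ω) (W ⊆ᵇ Ω))) ⟩
    ∑ (allSubsets (order G)) (ι ∘ P)
      ≡⟨ ∑-unique (order G) P unique ⟩
    ι (any P (allSubsets (order G)))
      ≡⟨ cong ι (bool-ext to from) ⟩
    ι (any (W ⊆ᵇ_) (Γ G Q)) ∎
    where
    P : VSet (order G) → Bool
    P Ω = isMaxAbsCQ G Q Ω ∧ (W ⊆ᵇ Ω)
    unique : ∀ X Y → P X ≡ true → P Y ≡ true → X ≡ Y
    unique X Y p q with ∧⁻ {isMaxAbsCQ G Q X} p | ∧⁻ {isMaxAbsCQ G Q Y} q
    ... | maxX , W⊆X | maxY , W⊆Y with disjointVisible⁻ dv (∈Γ⁺ G Q X maxX) (∈Γ⁺ G Q Y maxY)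
    ...   | inj₁ X≡Y = X≡Y
    ...   | inj₂ dis with nonempty⁻ W ne
    ...     | v , v∈W = true≢false (⊆ᵇ⁻ W Y W⊆Y v v∈W) (dis v (⊆ᵇ⁻ W X W⊆X v v∈W))
    to : any P (allSubsets (order G)) ≡ true → any (W ⊆ᵇ_) (Γ G Q) ≡ true
    to p with any⁻ P (allSubsets (order G)) p
    ... | Ω , _ , q with ∧⁻ {isMaxAbsCQ G Q Ω} q
    ...   | max , W⊆Ω = any⁺ (W ⊆ᵇ_) (∈Γ⁺ G Q Ω max) W⊆Ω
    from : any (W ⊆ᵇ_) (Γ G Q) ≡ true → any P (allSubsets (order G)) ≡ true
    from p with any⁻ (W ⊆ᵇ_) (Γ G Q) p
    ... | Ω , Ω∈Γ , W⊆Ω = any⁺ P (∈-allSubsets Ω) (∧⁺ (∈Γ⁻ G Q Ω Ω∈Γ) W⊆Ω)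

-- Coefficients of the right-hand side

∑-nonempty : ∀ {A : Set} (p : A → Bool) (f : A → ℤ) xs →
             ∑ xs (λ x → ι (p x) * f x) ≡ ∑ xs f - ∑ xs (λ x → ι (not (p x)) * f x)
∑-nonempty p f xs = trans (∑-cong xs λ x → pointwise (p x) (f x)) (∑-minus f _ xs)
  where
  pointwise : ∀ b z → ι b * z ≡ z - ι (not b) * z
  pointwise true  z = trans (*-identityˡ z) (sym (+-identityʳ z))
  pointwise false z = sym (trans (cong (λ w → z - w) (*-identityˡ z)) (+-inverseʳ z))

⊆ᵇ-empty : ∀ {n} (W Y : VSet n) → nonempty W ≡ false → W ⊆ᵇ Y ≡ true
⊆ᵇ-empty W Y e = ⊆ᵇ⁺ W Y λ v v∈W → true≢false v∈W (empty⁻ W e v)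

-- The family of empty blocks has its support inside every `Ω`; removing it gives the `- 1` of the
-- formula.
∑-nonempty-support-⊆ : ∀ {m} n (Ω : VSet m) (f : ℕ → ℤ) →
  ∑ (blocks m n) (λ Ts → ι (nonempty (support Ts)) * (ι (support Ts ⊆ᵇ Ω) * f (size Ts))) ≡
  ∑ˢ (∣ Ω ∣ˢ ℕ.* n) f - f 0
∑-nonempty-support-⊆ {m} n Ω f = trans (∑-nonempty (nonempty ∘ support) _ (blocks m n))
  (cong₂ _-_ (∑-support-⊆ n Ω f)
             (trans (∑-cong (blocks m n) λ Ts → drop-⊆ (support Ts) (f (size Ts))) (∑-blocks-empty n m f)))
  where
  drop-⊆ : ∀ W z → ι (not (nonempty W)) * (ι (W ⊆ᵇ Ω) * z) ≡ ι (not (nonempty W)) * z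
  drop-⊆ W z with nonempty W in eq
  ... | true  = refl
  ... | false = cong (_*_ (+ 1)) (trans (cong (λ b → ι b * z) (⊆ᵇ-empty W Ω eq)) (*-identityˡ z))

-- Weighted maximal sets, or weighted intersections of them, can stand for the whole
-- family of visible sets as soon as the weights count every non-empty visible set once.
∑-cover : ∀ {A : Set} {m} n (P : VSet m → Bool) (xs : List A) (w : A → ℤ) (Ω : A → VSet m) (f : ℕ → ℤ) →
  (∀ W → nonempty W ≡ true → ∑ xs (λ a → w a * ι (W ⊆ᵇ Ω a)) ≡ ι (P W)) →
  ∑ xs (λ a → w a * (∑ˢ (∣ Ω a ∣ˢ ℕ.* n) f - f 0)) ≡
  ∑ (blocks m n) (λ Ts → ι (nonempty (support Ts)) * (ι (P (support Ts)) * f (size Ts)))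
∑-cover {m = m} n P xs w Ω f covers = begin
  ∑ xs (λ a → w a * (∑ˢ (∣ Ω a ∣ˢ ℕ.* n) f - f 0))
    ≡⟨ ∑-cong xs (λ a → trans (cong (w a *_) (sym (∑-nonempty-support-⊆ n (Ω a) f))) (sym (∑-*ˡ (w a) _ (blocks m n)))) ⟩
  ∑ xs (λ a → ∑ (blocks m n) (λ Ts → w a * (ι (nonempty (support Ts)) * (ι (support Ts ⊆ᵇ Ω a) * f (size Ts)))))
    ≡⟨ ∑-swap _ xs (blocks m n) ⟩
  ∑ (blocks m n) (λ Ts → ∑ xs (λ a → w a * (ι (nonempty (support Ts)) * (ι (support Ts ⊆ᵇ Ω a) * f (size Ts)))))
    ≡⟨ ∑-cong (blocks m n) (λ Ts → pointwise (support Ts) (f (size Ts))) ⟩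
  ∑ (blocks m n) (λ Ts → ι (nonempty (support Ts)) * (ι (P (support Ts)) * f (size Ts))) ∎
  where
  pointwise : ∀ W z → ∑ xs (λ a → w a * (ι (nonempty W) * (ι (W ⊆ᵇ Ω a) * z))) ≡ ι (nonempty W) * (ι (P W) * z)
  pointwise W z with nonempty W in eq
  ... | false = trans (∑-cong xs λ a → *-zeroʳ (w a)) (∑-zero xs)
  ... | true  = begin
    ∑ xs (λ a → w a * (+ 1 * (ι (W ⊆ᵇ Ω a) * z)))
      ≡⟨ ∑-cong xs (λ a → begin
           w a * (+ 1 * (ι (W ⊆ᵇ Ω a) * z)) ≡⟨ cong (w a *_) (*-identityˡ (ι (W ⊆ᵇ Ω a) * z)) ⟩
           w a * (ι (W ⊆ᵇ Ω a) * z)         ≡⟨ *-assoc (w a) (ι (W ⊆ᵇ Ω a)) z ⟨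
           w a * ι (W ⊆ᵇ Ω a) * z           ≡⟨ *-comm (w a * ι (W ⊆ᵇ Ω a)) z ⟩
           z * (w a * ι (W ⊆ᵇ Ω a))         ∎) ⟩
    ∑ xs (λ a → z * (w a * ι (W ⊆ᵇ Ω a)))   ≡⟨ ∑-*ˡ z _ xs ⟩
    z * ∑ xs (λ a → w a * ι (W ⊆ᵇ Ω a))     ≡⟨ cong (z *_) (covers W eq) ⟩
    z * ι (P W)                             ≡⟨ *-comm z (ι (P W)) ⟩
    ι (P W) * z                             ≡⟨ *-identityˡ (ι (P W) * z) ⟨
    + 1 * (ι (P W) * z)                     ∎

-- Both branches are instances of `∑-cover`: weight 1 on the maximal sets themselves, or the
-- alternating sign on non-empty lists of them, represented by their intersections.
pQ-coefficient : ∀ G n Q i → pQ G n Q i ≡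
  ∑ (blocks (order G) n) (λ Ts → ι (nonempty (support Ts)) *
    (ι (isAbsCQ G Q (support Ts)) * δ i (∣ Q ∣ˢ ℕ.+ size Ts)))
pQ-coefficient G n Q i with isDisjointVisible G Q in dv
... | true  = trans (sumₚ-∑ _ (Γ G Q) i) (trans
  (∑-cong (Γ G Q) λ Ω → trans (shifted-binomial-∑ˢ (∣ Ω ∣ˢ ℕ.* n) ∣ Q ∣ˢ i) (sym (*-identityˡ _)))
  (∑-cover n (isAbsCQ G Q) (Γ G Q) (λ _ → + 1) (λ Ω → Ω) (λ t → δ i (∣ Q ∣ˢ ℕ.+ t)) λ W ne →
    trans (∑-cong (Γ G Q) λ Ω → *-identityˡ (ι (W ⊆ᵇ Ω)))
          (trans (∑-disjoint G Q dv W ne) (cong ι (sym (isAbsCQ-any G Q W))))))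
... | false = trans (sumₚ-∑ _ 𝒥 i) (trans
  (∑-cong 𝒥 λ J → cong (sign (length J) *_) (shifted-binomial-∑ˢ (∣ ⋂ J ∣ˢ ℕ.* n) ∣ Q ∣ˢ i))
  (∑-cover n (isAbsCQ G Q) 𝒥 (sign ∘ length) ⋂ (λ t → δ i (∣ Q ∣ˢ ℕ.+ t)) λ W _ →
    trans (inclusion-exclusion W (Γ G Q)) (cong ι (sym (isAbsCQ-any G Q W)))))
  where
  𝒥 : List (List (VSet (order G)))
  𝒥 = filter (λ J → 1 ℕ.≤? length J) (sublists (Γ G Q))

∑-size : ∀ m n (f : ℕ → ℤ) → ∑ (blocks m n) (f ∘ size) ≡ ∑ˢ (m ℕ.* n) f
∑-size m n f = sym (∑-concat m n (λ T → f ∣ T ∣ˢ))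

copies-coefficient : ∀ m n i →
  ∑ (blocks m n) (λ Ts → ι (nonempty (support Ts)) * δ i (size Ts)) ≡
  ((1ₚ +ₚ xₚ) ^ₚ (m ℕ.* n) -ₚ 1ₚ) i
copies-coefficient m n i = trans (∑-nonempty (nonempty ∘ support) (δ i ∘ size) (blocks m n))
  (cong₂ _-_ (trans (∑-size m n (δ i)) (sym (binomial-∑ˢ (m ℕ.* n) i)))
             (trans (∑-blocks-empty n m (δ i)) (sym (1ₚ-δ i))))

count-coefficient : ∀ {n} (P : VSet n → Bool) i →
  + countᵇ (λ X → (∣ X ∣ˢ ≡ᵇ i) ∧ P X) (allSubsets n) ≡ ∑ (allSubsets n) (λ X → ι (P X) * δ i ∣ X ∣ˢ)
count-coefficient {n} P i = trans (countᵇ-∑ _ (allSubsets n)) (∑-cong (allSubsets n) λ X →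
  trans (ι-∧ (∣ X ∣ˢ ≡ᵇ i) (P X)) (*-comm (δ i ∣ X ∣ˢ) (ι (P X))))

module _ (G H : Graph) where
  open Corona G H using (blockOK)

  blockOK-∅ : blockOK ∅ˢ ≡ true
  blockOK-∅ = ∧⁺ (setVisible⁺ H ∅ˢ ∅ˢ λ u _ u∈∅ → true≢false u∈∅ (∅ˢ-∉ u))
                 (all₂⁺ (_∈ᵇ ∅ˢ {order H}) (_∈ᵇ ∅ˢ {order H}) (λ u v → dist H u v ≤ᵇ 2) λ u _ u∈∅ → true≢false u∈∅ (∅ˢ-∉ u))

  -- The `suc` accounts for the centre, which belongs to the set along with its block; the `-ₚ 1ₚ`
  -- removes the empty block, which satisfies `blockOK`.
  blockOK-coefficient : ∀ i →
    ∑ (allSubsets (order H)) (λ S → ι (blockOK S ∧ nonempty S) * δ i (suc ∣ S ∣ˢ)) ≡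
    (xₚ *ₚ (visPolyD 2 H -ₚ 1ₚ)) i
  blockOK-coefficient zero = trans (∑-cong (allSubsets (order H)) λ S → *-zeroʳ (ι (blockOK S ∧ nonempty S)))
    (trans (∑-zero (allSubsets (order H))) (sym (*ₚ-zero xₚ (visPolyD 2 H -ₚ 1ₚ))))
  blockOK-coefficient (suc i) = begin
    ∑ subsets (λ S → ι (blockOK S ∧ nonempty S) * δ i ∣ S ∣ˢ)
      ≡⟨ ∑-cong subsets (λ S → trans (cong (_* δ i ∣ S ∣ˢ) (trans (ι-∧ (blockOK S) (nonempty S)) (*-comm (ι (blockOK S)) _)))
                                     (*-assoc (ι (nonempty S)) (ι (blockOK S)) _)) ⟩
    ∑ subsets (λ S → ι (nonempty S) * (ι (blockOK S) * δ i ∣ S ∣ˢ))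
      ≡⟨ ∑-nonempty nonempty _ subsets ⟩
    ∑ subsets (λ S → ι (blockOK S) * δ i ∣ S ∣ˢ) - ∑ subsets (λ S → ι (not (nonempty S)) * (ι (blockOK S) * δ i ∣ S ∣ˢ))
      ≡⟨ cong₂ _-_ (sym (count-coefficient blockOK i)) (∑-empty (order H) (λ S → ι (blockOK S) * δ i ∣ S ∣ˢ)) ⟩
    visPolyD 2 H i - ι (blockOK ∅ˢ) * δ i ∣ ∅ˢ {order H} ∣ˢ
      ≡⟨ cong (λ z → visPolyD 2 H i - z) (trans (cong₂ (λ b k → ι b * δ i k) blockOK-∅ (∣∅∣ (order H)))
           (trans (*-identityˡ (δ i 0)) (sym (1ₚ-δ i)))) ⟩
    (visPolyD 2 H -ₚ 1ₚ) i
      ≡⟨ x*-suc (visPolyD 2 H -ₚ 1ₚ) i ⟨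
    (xₚ *ₚ (visPolyD 2 H -ₚ 1ₚ)) (suc i) ∎
    where
    subsets : List (VSet (order H))
    subsets = allSubsets (order H)

-- Splitting the sum over the visible sets

1≤∣∣ : ∀ {n} (X : VSet n) → (1 ≤ᵇ ∣ X ∣ˢ) ≡ nonempty X
1≤∣∣ []          = refl
1≤∣∣ (true  ∷ X) = refl
1≤∣∣ (false ∷ X) = 1≤∣∣ X

∉⇒∣∣< : ∀ {n} (X : VSet n) v → v ∈ᵇ X ≡ false → ∣ X ∣ˢ < n
∉⇒∣∣< (false ∷ X) zero    p = s≤s (count≤n (_≟ true) X)
∉⇒∣∣< (true  ∷ X) (suc v) p = s≤s (∉⇒∣∣< X v p)
∉⇒∣∣< (false ∷ X) (suc v) p = m≤n⇒m≤1+n (∉⇒∣∣< X v p)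

module _ (G : Graph) (conn : IsConnected G) (Q : VSet (order G)) where

  isAbsCQ-∅ : ∀ W → nonempty W ≡ false → isAbsCQ G Q W ≡ isMV G Q
  isAbsCQ-∅ W e = bool-ext (λ abs → proj₂ (∧⁻ {isCQ G Q W} abs)) λ mv → isAbsCQ⁺ G Q W record
    { disjoint = λ w w∈W → true≢false w∈W (empty⁻ W e w)
    ; within   = λ u _ u∈W → true≢false u∈W (empty⁻ W e u)
    ; across   = λ _ w _ w∈W → true≢false w∈W (empty⁻ W e w)
    ; internal = setVisible⁻ G Q Q mv
    }

  -- With nothing blocked, the geodesics supplied by connectedness make all pairs visible. Every
  -- support is then allowed, which yields (1+x)^(mn) - 1.
  ∅-isAbsCQ : nonempty Q ≡ false → ∀ W → isAbsCQ G Q W ≡ true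
  ∅-isAbsCQ e W = isAbsCQ⁺ G Q W record
    { disjoint = λ w _ → empty⁻ Q e w
    ; within   = λ u w _ _ → free u w
    ; across   = λ u w _ _ → free u w
    ; internal = λ u v _ _ → free u v
    }
    where
    unblock : ∀ {k u v} → Path G ∅ˢ k u v → Path G Q k u v
    unblock nil          = nil
    unblock (edge a)     = edge a
    unblock (step {w = w} a _ p) = step a (empty⁻ Q e w) (unblock p)
    free : ∀ u v → Visible G Q u v
    free u v = along (unblock (connected-path conn u v))

  -- A vertex of `W` lies outside `Q`, which is why the sum runs over proper subsets only.
  isAbsCQ⇒admissible : ∀ W → nonempty Q ≡ true → nonempty W ≡ true → isAbsCQ G Q W ≡ true → admissibleQ G Q ≡ true
  isAbsCQ⇒admissible W neQ neW abs with nonempty⁻ W neW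
  ... | w , w∈W = ∧⁺ (trans (1≤∣∣ Q) neQ)
    (∧⁺ (Equivalence.to T-≡ (<⇒<ᵇ (∉⇒∣∣< Q w (AbsVisible.disjoint (isAbsCQ⁻ G Q W abs) w w∈W))))
        (proj₂ (∧⁻ {isCQ G Q W} abs)))

  empty⇒inadmissible : nonempty Q ≡ false → admissibleQ G Q ≡ false
  empty⇒inadmissible e = cong (_∧ ((∣ Q ∣ˢ <ᵇ order G) ∧ isMV G Q)) (trans (1≤∣∣ Q) e)

  -- The pair with `Q` and `W` both empty satisfies two descriptions and is assigned to V(G); the
  -- second summand therefore asks for `W` non-empty, and the third for both to be so.
  ι-isAbsCQ-split : ∀ W z → ι (isAbsCQ G Q W) * z ≡
    ι (not (nonempty W)) * (ι (isMV G Q) * z) +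
    (ι (not (nonempty Q)) * (ι (nonempty W) * z) + ι (admissibleQ G Q) * (ι (nonempty W) * (ι (isAbsCQ G Q W) * z)))
  ι-isAbsCQ-split W z =
    -- The five decisions become Boolean variables and their dependencies hypotheses, which leaves a
    -- finite check by evaluating `ι`.
    cases (nonempty W) (nonempty Q) (isAbsCQ G Q W) (isMV G Q) (admissibleQ G Q)
          (isAbsCQ-∅ W) (λ e → ∅-isAbsCQ e W) (isAbsCQ⇒admissible W) empty⇒inadmissible
    where
    cases : ∀ neW neQ abs mv adm → (neW ≡ false → abs ≡ mv) → (neQ ≡ false → abs ≡ true) →
            (neQ ≡ true → neW ≡ true → abs ≡ true → adm ≡ true) → (neQ ≡ false → adm ≡ false) →
            ι abs * z ≡ ι (not neW) * (ι mv * z) + (ι (not neQ) * (ι neW * z) + ι adm * (ι neW * (ι abs * z)))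
    cases false neQ abs mv adm h₁ _ _ _ = begin
      ι abs * z                    ≡⟨ cong (λ b → ι b * z) (h₁ refl) ⟩
      ι mv * z                     ≡⟨ *-identityˡ (ι mv * z) ⟨
      + 1 * (ι mv * z)             ≡⟨ +-identityʳ _ ⟨
      + 1 * (ι mv * z) + (+ 0 + + 0) ≡⟨ cong (λ w → + 1 * (ι mv * z) + w) (cong₂ _+_ (*-zeroʳ (ι (not neQ))) (*-zeroʳ (ι adm))) ⟨
      + 1 * (ι mv * z) + (ι (not neQ) * + 0 + ι adm * + 0) ∎
    cases true false abs mv adm _ h₂ _ h₄ = begin
      ι abs * z                    ≡⟨ cong (λ b → ι b * z) (h₂ refl) ⟩
      + 1 * z                      ≡⟨ *-identityˡ (+ 1 * z) ⟨
      + 1 * (+ 1 * z)              ≡⟨ trans (+-identityˡ _) (+-identityʳ _) ⟨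
      + 0 + (+ 1 * (+ 1 * z) + + 0)
        ≡⟨ cong (λ b → + 0 + (+ 1 * (+ 1 * z) + ι b * (+ 1 * (ι abs * z)))) (h₄ refl) ⟨
      + 0 + (+ 1 * (+ 1 * z) + ι adm * (+ 1 * (ι abs * z))) ∎
    cases true true false mv adm _ _ _ _ = begin
      + 0 ≡⟨ *-zeroʳ (ι adm) ⟨
      ι adm * + 0 ≡⟨ trans (+-identityˡ _) (+-identityˡ _) ⟨
      + 0 + (+ 0 + ι adm * + 0) ∎
    cases true true true mv adm _ _ h₃ _ with refl ← h₃ refl refl refl = begin
      + 1 * z                                 ≡⟨ *-identityˡ (+ 1 * z) ⟨
      + 1 * (+ 1 * z)                         ≡⟨ *-identityˡ (+ 1 * (+ 1 * z)) ⟨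
      + 1 * (+ 1 * (+ 1 * z))                 ≡⟨ trans (+-identityˡ _) (+-identityˡ _) ⟨
      + 0 + (+ 0 + + 1 * (+ 1 * (+ 1 * z)))   ∎

  ∑-isAbsCQ : ∀ n i →
    ∑ (blocks (order G) n) (λ Ts → ι (isAbsCQ G Q (support Ts)) * δ i (∣ Q ∣ˢ ℕ.+ size Ts)) ≡
    ι (isMV G Q) * δ i ∣ Q ∣ˢ +
    (ι (not (nonempty Q)) * ∑ (blocks (order G) n) (λ Ts → ι (nonempty (support Ts)) * δ i (∣ Q ∣ˢ ℕ.+ size Ts))
     + ι (admissibleQ G Q) * pQ G n Q i)
  ∑-isAbsCQ n i = begin
    ∑ bs (λ Ts → ι (isAbsCQ G Q (support Ts)) * d Ts)
      ≡⟨ ∑-cong bs (λ Ts → ι-isAbsCQ-split (support Ts) (d Ts)) ⟩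
    ∑ bs (λ Ts → f₁ Ts + (ι (not (nonempty Q)) * f₂ Ts + ι (admissibleQ G Q) * f₃ Ts))
      ≡⟨ trans (∑-+ f₁ _ bs) (cong (_+_ (∑ bs f₁)) (trans (∑-+ _ _ bs)
           (cong₂ _+_ (∑-*ˡ (ι (not (nonempty Q))) f₂ bs) (∑-*ˡ (ι (admissibleQ G Q)) f₃ bs)))) ⟩
    ∑ bs f₁ + (ι (not (nonempty Q)) * ∑ bs f₂ + ι (admissibleQ G Q) * ∑ bs f₃)
      ≡⟨ cong₂ (λ a b → a + (ι (not (nonempty Q)) * ∑ bs f₂ + ι (admissibleQ G Q) * b))
           (trans (∑-blocks-empty n (order G) (λ t → ι (isMV G Q) * δ i (∣ Q ∣ˢ ℕ.+ t)))
                  (cong (λ k → ι (isMV G Q) * δ i k) (ℕP.+-identityʳ ∣ Q ∣ˢ)))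
           (sym (pQ-coefficient G n Q i)) ⟩
    ι (isMV G Q) * δ i ∣ Q ∣ˢ + (ι (not (nonempty Q)) * ∑ bs f₂ + ι (admissibleQ G Q) * pQ G n Q i) ∎
    where
    bs : List (Vec (VSet n) (order G))
    bs = blocks (order G) n
    d f₁ f₂ f₃ : Vec (VSet n) (order G) → ℤ
    d Ts  = δ i (∣ Q ∣ˢ ℕ.+ size Ts)
    f₁ Ts = ι (not (nonempty (support Ts))) * (ι (isMV G Q) * d Ts)
    f₂ Ts = ι (nonempty (support Ts)) * d Ts
    f₃ Ts = ι (nonempty (support Ts)) * (ι (isAbsCQ G Q (support Ts)) * d Ts)

-- Coefficients of the visibility polynomial of the corona

module _ (G H : Graph) (simpleG : IsSimple G) (conn : IsConnected G) (simpleH : IsSimple H) where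

  private
    m = order G
    n = order H

    Qs : List (VSet m)
    Qs = allSubsets m

    bs : List (Vec (VSet n) m)
    bs = blocks m n

  open Corona G H

  ι-isMV : ∀ Q Ts → ι (isMV (corona G H) (Q V.++ concat Ts)) ≡ ι (isAbsCQ G Q (support Ts)) + ι (centred blockOK Q Ts)
  ι-isMV Q Ts = cases _ _ _ mv⇒abs⊎centred abs⇒mv centred⇒mv abs∧centred-absurd
    where
    open Characterisation (proj₁ simpleG) (proj₁ simpleH) Q Ts
    cases : ∀ mv abs cen → (mv ≡ true → abs ≡ true ⊎ cen ≡ true) → (abs ≡ true → mv ≡ true) →
            (cen ≡ true → mv ≡ true) → (abs ≡ true → cen ≡ true → ⊥) → ι mv ≡ ι abs + ι cen
    cases _     true  true  _ _ _ h = ⊥-elim (h refl refl)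
    cases mv    true  false _ h _ _ = cong ι (h refl)
    cases mv    false true  _ _ h _ = cong ι (h refl)
    cases false false false _ _ _ _ = refl
    cases true  false false h _ _ _ with h refl
    ... | inj₁ ()
    ... | inj₂ ()

  ∑-corona : ∀ i → visPoly (corona G H) i ≡
    ∑ Qs (λ Q → ∑ bs (λ Ts → ι (isAbsCQ G Q (support Ts)) * δ i (∣ Q ∣ˢ ℕ.+ size Ts))) +
    ∑ Qs (λ Q → ∑ bs (λ Ts → ι (centred blockOK Q Ts) * δ i (suc (size Ts))))
  ∑-corona i = begin
    visPoly (corona G H) i
      ≡⟨ count-coefficient (isMV (corona G H)) i ⟩
    ∑ (allSubsets (m ℕ.+ m ℕ.* n)) (λ X → ι (isMV (corona G H) X) * δ i ∣ X ∣ˢ)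
      ≡⟨ ∑-subsets-++ m (m ℕ.* n) _ ⟩
    ∑ Qs (λ Q → ∑ (allSubsets (m ℕ.* n)) (λ Y → ι (isMV (corona G H) (Q V.++ Y)) * δ i ∣ Q V.++ Y ∣ˢ))
      ≡⟨ ∑-cong Qs (λ Q → trans (∑-concat m n _) (trans (∑-cong bs (term Q)) (∑-+ _ _ bs))) ⟩
    ∑ Qs (λ Q → ∑ bs (λ Ts → ι (isAbsCQ G Q (support Ts)) * δ i (∣ Q ∣ˢ ℕ.+ size Ts)) +
                ∑ bs (λ Ts → ι (centred blockOK Q Ts) * δ i (suc (size Ts))))
      ≡⟨ ∑-+ _ _ Qs ⟩
    _ ∎
    where
    centred-term : ∀ Q Ts → ι (centred blockOK Q Ts) * δ i (∣ Q ∣ˢ ℕ.+ size Ts) ≡ ι (centred blockOK Q Ts) * δ i (suc (size Ts))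
    centred-term Q Ts with centred blockOK Q Ts in cen
    ... | false = refl
    ... | true  = cong (λ k → + 1 * δ i (k ℕ.+ size Ts)) (centred-size blockOK Q Ts cen)
    term : ∀ Q Ts → ι (isMV (corona G H) (Q V.++ concat Ts)) * δ i ∣ Q V.++ concat Ts ∣ˢ ≡
           ι (isAbsCQ G Q (support Ts)) * δ i (∣ Q ∣ˢ ℕ.+ size Ts) + ι (centred blockOK Q Ts) * δ i (suc (size Ts))
    term Q Ts = begin
      ι (isMV (corona G H) (Q V.++ concat Ts)) * δ i ∣ Q V.++ concat Ts ∣ˢ
        ≡⟨ cong₂ _*_ (ι-isMV Q Ts) (cong (δ i) (∣++∣ Q (concat Ts))) ⟩
      (ι (isAbsCQ G Q (support Ts)) + ι (centred blockOK Q Ts)) * δ i (∣ Q ∣ˢ ℕ.+ size Ts)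
        ≡⟨ *-distribʳ-+ (δ i (∣ Q ∣ˢ ℕ.+ size Ts)) (ι (isAbsCQ G Q (support Ts))) _ ⟩
      ι (isAbsCQ G Q (support Ts)) * δ i (∣ Q ∣ˢ ℕ.+ size Ts) + ι (centred blockOK Q Ts) * δ i (∣ Q ∣ˢ ℕ.+ size Ts)
        ≡⟨ cong (_+_ (ι (isAbsCQ G Q (support Ts)) * δ i (∣ Q ∣ˢ ℕ.+ size Ts))) (centred-term Q Ts) ⟩
      _ ∎

  ∑-abs-coefficient : ∀ i →
    ∑ Qs (λ Q → ∑ bs (λ Ts → ι (isAbsCQ G Q (support Ts)) * δ i (∣ Q ∣ˢ ℕ.+ size Ts))) ≡
    visPoly G i + (((1ₚ +ₚ xₚ) ^ₚ (m ℕ.* n) -ₚ 1ₚ) i +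
                   sumₚ (map (pQ G n) (filter (λ Q → admissibleQ G Q ≟ true) Qs)) i)
  ∑-abs-coefficient i = begin
    _ ≡⟨ ∑-cong Qs (λ Q → ∑-isAbsCQ G conn Q n i) ⟩
    ∑ Qs (λ Q → f₁ Q + (f₂ Q + f₃ Q))
      ≡⟨ trans (∑-+ f₁ (λ Q → f₂ Q + f₃ Q) Qs) (cong (_+_ (∑ Qs f₁)) (∑-+ f₂ f₃ Qs)) ⟩
    ∑ Qs f₁ + (∑ Qs f₂ + ∑ Qs f₃)
      ≡⟨ cong₂ _+_ (sym (count-coefficient (isMV G) i)) (cong₂ _+_
           (trans (∑-empty m (λ Q → E ∣ Q ∣ˢ)) (trans (cong E (∣∅∣ m)) (copies-coefficient m n i)))
           (sym (trans (sumₚ-∑ (pQ G n) (filter (λ Q → admissibleQ G Q ≟ true) Qs) i) (∑-filter (admissibleQ G) (λ Q → pQ G n Q i) Qs)))) ⟩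
    _ ∎
    where
    E : ℕ → ℤ
    E q = ∑ bs (λ Ts → ι (nonempty (support Ts)) * δ i (q ℕ.+ size Ts))
    f₁ f₂ f₃ : VSet m → ℤ
    f₁ Q = ι (isMV G Q) * δ i ∣ Q ∣ˢ
    f₂ Q = ι (not (nonempty Q)) * E ∣ Q ∣ˢ
    f₃ Q = ι (admissibleQ G Q) * pQ G n Q i

mainTheorem19 : (G H : Graph) → IsSimple G → IsConnected G → IsSimple H → IsConnected H →
    1 < order G →
    visPoly (corona G H)
    ≈ₚ (visPoly G
    +ₚ ((1ₚ +ₚ xₚ) ^ₚ (order G Data.Nat.* order H) -ₚ 1ₚ)
    +ₚ (+ order G) ·ₚ (xₚ *ₚ (visPolyD 2 H -ₚ 1ₚ))
    +ₚ sumₚ (map (pQ G (order H)) (filter (λ Q → admissibleQ G Q ≟ true) (allSubsets (order G)))))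
mainTheorem19 G H simpleG connG simpleH _ _ i = begin
  visPoly (corona G H) i
    ≡⟨ ∑-corona G H simpleG connG simpleH i ⟩
  _ ≡⟨ cong₂ _+_ (∑-abs-coefficient G H simpleG connG simpleH i)
                 (trans (∑-centred (order H) (Corona.blockOK G H) (order G) (δ i ∘ suc))
                        (cong (_*_ (+ order G)) (blockOK-coefficient G H i))) ⟩
  v + (b + s) + c      ≡⟨ +-assoc v (b + s) c ⟩
  v + (b + s + c)      ≡⟨ cong (_+_ v) (trans (+-assoc b s c) (cong (_+_ b) (+-comm s c))) ⟩
  v + (b + (c + s))    ≡⟨ +-assoc v b (c + s) ⟨
  v + b + (c + s)      ≡⟨ +-assoc (v + b) c s ⟨
  v + b + c + s        ∎
  where
  v b c s : ℤ
  v = visPoly G i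
  b = ((1ₚ +ₚ xₚ) ^ₚ (order G ℕ.* order H) -ₚ 1ₚ) i
  c = + order G * (xₚ *ₚ (visPolyD 2 H -ₚ 1ₚ)) i
  s = sumₚ (map (pQ G (order H)) (filter (λ Q → admissibleQ G Q ≟ true) (allSubsets (order G)))) i
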